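{- The functor $G:\mathbf{cMet}_1\to\mathrm{ER}(\mathbf U)$, $G(X,d)=(X,d)$, $G(f)=[(x,y)\mapsto d(f(x),y)]$, is an equivalence of categories.
   Context: $\mathbf{cMet}_1$: complete metric spaces with all distances $\le 1$ and uniformly continuous maps. For functions $\alpha,\beta:Z\to[0,1]$ write $\alpha\sqsubseteq\beta$ if for every $\varepsilon>0$ there exists $\delta>0$ such that for all $z\in Z$, $\alpha(z)\le\delta$ implies $\beta(z)\le\varepsilon$. The category $\mathrm{ER}(\mathbf U)$: objects are pairs $(X,R)$ with $X$ a set and $R:X\times X\to[0,1]$ such that $R(x,x)=0$ for all $x$, $R(x,y)\sqsubseteq R(y,x)$ as functions of $(x,y)$, and $\max(R(x,y),R(y,z))\sqsubseteq R(x,z)$ as functions of $(x,y,z)$. A functional relation $(X,R)\to(Y,S)$ is a function $F:X\times Y\to[0,1]$ with $\max(F(x,y),R(x,x'),S(y,y'))\sqsubseteq F(x',y')$ as functions of $(x,x',y,y')$, $\max(F(x,y),F(x,y'))\sqsubseteq S(y,y')$ as functions of $(x,y,y')$, and $\inf_{y\in Y}F(x,y)=0$ for all $x$. Morphisms are equivalence classes $[F]$ of functional relations, with $F\sim F'$ iff $F\sqsubseteq F'$ as functions on $X\times Y$; identity $[R]$; composite of $[F]$ and $[H]$ is $[(x,z)\mapsto\inf_y\max(F(x,y),H(y,z))]$. -}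

module Defs where

open import Level using (Level; 0ℓ; _⊔_) renaming (suc to lsuc)
open import Data.Nat as ℕ using (ℕ)
open import Data.Rational as ℚ using (ℚ; 0ℚ; 1ℚ; ½)
import Data.Rational.Properties as ℚP
open import Function using (case_of_)
open import Data.Product using (Σ; ∃; _×_; _,_; proj₁; proj₂)
open import Data.Sum using (_⊎_; inj₁; inj₂)
open import Data.Empty using (⊥-elim)
open import Relation.Nullary using (¬_; yes; no)
open import Relation.Binary.Bundles using (Setoid)
open import Relation.Binary.Structures using (IsEquivalence)
open import Relation.Binary.PropositionalEquality using (refl; sym; trans; subst)

-- Quotients being unavailable, the morphisms between two objects form a
-- setoid; an equivalence class of representatives is a morphism up to _≈_.
record Category (o h e : Level) : Set (lsuc (o ⊔ h ⊔ e)) where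
  infix  4 _≈_ _⇒_
  infixr 9 _∘_
  field
    Obj       : Set o
    _⇒_       : Obj → Obj → Set h
    _≈_       : ∀ {A B} → A ⇒ B → A ⇒ B → Set e
    id        : ∀ {A} → A ⇒ A
    _∘_       : ∀ {A B C} → B ⇒ C → A ⇒ B → A ⇒ C
    equiv     : ∀ {A B} → IsEquivalence (_≈_ {A} {B})
    ∘-cong    : ∀ {A B C} {g g′ : B ⇒ C} {f f′ : A ⇒ B} →
                g ≈ g′ → f ≈ f′ → g ∘ f ≈ g′ ∘ f′
    assoc     : ∀ {A B C D} (f : A ⇒ B) (g : B ⇒ C) (h : C ⇒ D) →
                (h ∘ g) ∘ f ≈ h ∘ (g ∘ f)
    identityˡ : ∀ {A B} (f : A ⇒ B) → id ∘ f ≈ f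
    identityʳ : ∀ {A B} (f : A ⇒ B) → f ∘ id ≈ f

  module Equiv {A B : Obj} = IsEquivalence (equiv {A} {B})

module _ {o h e o′ h′ e′ : Level} (C : Category o h e) (D : Category o′ h′ e′) where
  private
    module C = Category C
    module D = Category D

  record Functor : Set (o ⊔ h ⊔ e ⊔ o′ ⊔ h′ ⊔ e′) where
    field
      F₀     : C.Obj → D.Obj
      F₁     : ∀ {A B} → A C.⇒ B → F₀ A D.⇒ F₀ B
      F-cong : ∀ {A B} {f g : A C.⇒ B} → f C.≈ g → F₁ f D.≈ F₁ g
      F-id   : ∀ {A} → F₁ (C.id {A}) D.≈ D.id
      F-∘    : ∀ {A B E} (f : A C.⇒ B) (g : B C.⇒ E) →
               F₁ (g C.∘ f) D.≈ F₁ g D.∘ F₁ f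

module _ {o h e o′ h′ e′ : Level} {C : Category o h e} {D : Category o′ h′ e′} where
  private
    module C = Category C
    module D = Category D

  record NaturalIsomorphism (F G : Functor C D) : Set (o ⊔ h ⊔ h′ ⊔ e′) where
    private
      module F = Functor F
      module G = Functor G
    field
      to      : ∀ A → F.F₀ A D.⇒ G.F₀ A
      from    : ∀ A → G.F₀ A D.⇒ F.F₀ A
      natural : ∀ {A B} (f : A C.⇒ B) → to B D.∘ F.F₁ f D.≈ G.F₁ f D.∘ to A
      to∘from : ∀ A → to A D.∘ from A D.≈ D.id
      from∘to : ∀ A → from A D.∘ to A D.≈ D.id

idF : ∀ {o h e} {C : Category o h e} → Functor C C
idF {C = C} = record
  { F₀ = λ A → A ; F₁ = λ f → f ; F-cong = λ p → p
  ; F-id = Equiv.refl ; F-∘ = λ _ _ → Equiv.refl }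
  where open Category C

infixr 9 _∘F_
_∘F_ : ∀ {o h e o′ h′ e′ o″ h″ e″}
         {C : Category o h e} {D : Category o′ h′ e′} {E : Category o″ h″ e″} →
       Functor D E → Functor C D → Functor C E
_∘F_ {E = E} G F = record
  { F₀     = λ A → G.F₀ (F.F₀ A)
  ; F₁     = λ f → G.F₁ (F.F₁ f)
  ; F-cong = λ p → G.F-cong (F.F-cong p)
  ; F-id   = Equiv.trans (G.F-cong F.F-id) G.F-id
  ; F-∘    = λ f g → Equiv.trans (G.F-cong (F.F-∘ f g)) (G.F-∘ _ _) }
  where
    module F = Functor F
    module G = Functor G
    open Category E

record IsEquivalenceOfCategories
  {o h e o′ h′ e′} {C : Category o h e} {D : Category o′ h′ e′}
  (F : Functor C D) : Set (o ⊔ h ⊔ e ⊔ o′ ⊔ h′ ⊔ e′) where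
  field
    inverse : Functor D C
    unit    : NaturalIsomorphism idF (inverse ∘F F)
    counit  : NaturalIsomorphism (F ∘F inverse) idF

-- One-sided Dedekind cuts: a real number a is given by the set of rationals
-- q with a < q, an inhabited, proper, open up-set of ℚ.  Keeping only one
-- half of the cut loses nothing classically, and it makes arbitrary infima
-- in [0,1] available without excluded middle.
record ℝ : Set₁ where
  field
    Above     : ℚ → Set
    inhabited : ∃ λ q → Above q
    proper    : ∃ λ q → ¬ Above q
    upward    : ∀ {p q} → Above p → p ℚ.< q → Above q
    open-     : ∀ {q} → Above q → ∃ λ p → p ℚ.< q × Above p

open ℝ public using (Above)

infix 4 _≤_ _≃_ _<_

_≤_ : ℝ → ℝ → Set
a ≤ b = ∀ q → Above b q → Above a q

_≃_ : ℝ → ℝ → Set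
a ≃ b = a ≤ b × b ≤ a

-- a < q ≤ b for some rational q; ¬ Above b q says q ≤ b.
_<_ : ℝ → ℝ → Set
a < b = ∃ λ q → Above a q × ¬ Above b q

q<q+1 : ∀ q → q ℚ.< q ℚ.+ 1ℚ
q<q+1 q = subst (ℚ._< q ℚ.+ 1ℚ) (ℚP.+-identityʳ q)
                (ℚP.+-monoʳ-< q (ℚP.positive⁻¹ 1ℚ))

Above-mono : ∀ (a : ℝ) {p q} → Above a p → p ℚ.≤ q → Above a q
Above-mono a {p} {q} ap p≤q with ℝ.open- a ap
... | r , r<p , ar = ℝ.upward a ar (ℚP.<-≤-trans r<p p≤q)

not-Above⇒< : ∀ (a : ℝ) {p q} → ¬ Above a p → Above a q → p ℚ.< q
not-Above⇒< a {p} {q} ¬ap aq with p ℚP.<? q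
... | yes p<q = p<q
... | no  p≮q = ⊥-elim (¬ap (Above-mono a aq (ℚP.≮⇒≥ p≮q)))

fromℚ : ℚ → ℝ
fromℚ p = record
  { Above     = λ q → p ℚ.< q
  ; inhabited = p ℚ.+ 1ℚ , q<q+1 p
  ; proper    = p , ℚP.<-irrefl refl
  ; upward    = ℚP.<-trans
  ; open-     = λ p<q → let m , p<m , m<q = ℚP.<-dense p<q in m , m<q , p<m
  }

0ℝ 1ℝ : ℝ
0ℝ = fromℚ 0ℚ
1ℝ = fromℚ 1ℚ

infixl 6 _+_
_+_ : ℝ → ℝ → ℝ
a + b = record
  { Above     = λ q → ∃ λ r → ∃ λ s → Above a r × Above b s × r ℚ.+ s ℚ.< q
  ; inhabited =
      let r , ar = ℝ.inhabited a
          s , bs = ℝ.inhabited b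
      in r ℚ.+ s ℚ.+ 1ℚ , r , s , ar , bs , q<q+1 (r ℚ.+ s)
  ; proper    =
      let r₀ , ¬ar = ℝ.proper a
          s₀ , ¬bs = ℝ.proper b
      in r₀ ℚ.+ s₀ , λ (r , s , ar , bs , r+s<) →
           ℚP.<-irrefl refl (ℚP.<-trans r+s<
             (ℚP.+-mono-< (not-Above⇒< a ¬ar ar) (not-Above⇒< b ¬bs bs)))
  ; upward    = λ (r , s , ar , bs , r+s<p) p<q →
      r , s , ar , bs , ℚP.<-trans r+s<p p<q
  ; open-     = λ (r , s , ar , bs , r+s<q) →
      let m , r+s<m , m<q = ℚP.<-dense r+s<q in m , m<q , r , s , ar , bs , r+s<m
  }

max : ℝ → ℝ → ℝ
max a b = record
  { Above     = λ q → Above a q × Above b q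
  ; inhabited =
      let r , ar = ℝ.inhabited a
          s , bs = ℝ.inhabited b
      in r ℚ.⊔ s , Above-mono a ar (ℚP.p≤p⊔q r s) , Above-mono b bs (ℚP.p≤q⊔p r s)
  ; proper    = let r₀ , ¬ar = ℝ.proper a in r₀ , λ (ar , _) → ¬ar ar
  ; upward    = λ (ap , bp) p<q → ℝ.upward a ap p<q , ℝ.upward b bp p<q
  ; open-     = λ (aq , bq) →
      let r , r<q , ar = ℝ.open- a aq
          s , s<q , bs = ℝ.open- b bq
      in r ℚ.⊔ s , ⊔-< r<q s<q
         , Above-mono a ar (ℚP.p≤p⊔q r s) , Above-mono b bs (ℚP.p≤q⊔p r s)
  }
  where
    ⊔-< : ∀ {r s q} → r ℚ.< q → s ℚ.< q → r ℚ.⊔ s ℚ.< q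
    ⊔-< {r} {s} {q} r<q s<q with ℚP.⊔-sel r s
    ... | inj₁ e = subst (ℚ._< q) (sym e) r<q
    ... | inj₂ e = subst (ℚ._< q) (sym e) s<q

record 𝕀 : Set₁ where
  constructor mk𝕀
  field
    value   : ℝ
    0≤value : 0ℝ ≤ value
    value≤1 : value ≤ 1ℝ

open 𝕀 public using (value)

infix 4 _≃ᵢ_
_≃ᵢ_ : 𝕀 → 𝕀 → Set
a ≃ᵢ b = value a ≃ value b

0ᵢ : 𝕀
0ᵢ = mk𝕀 0ℝ (λ _ p → p) (λ _ p → ℚP.<-trans (ℚP.positive⁻¹ 1ℚ) p)

infixl 6 _∨_
_∨_ : 𝕀 → 𝕀 → 𝕀
a ∨ b = mk𝕀 (max (value a) (value b))
            (λ q (aq , _) → 𝕀.0≤value a q aq)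
            (λ q p → 𝕀.value≤1 a q p , 𝕀.value≤1 b q p)

-- The infimum in the complete lattice [0,1]; the infimum of the empty
-- family is 1.
inf : {Y : Set} → (Y → 𝕀) → 𝕀
inf {Y} f = record
  { value = record
      { Above     = λ q → 1ℚ ℚ.< q ⊎ ∃ λ y → Above (value (f y)) q
      ; inhabited = 1ℚ ℚ.+ 1ℚ , inj₁ (q<q+1 1ℚ)
      ; proper    = 0ℚ , λ p → ℚP.<-irrefl refl (nonneg 0ℚ p)
      ; upward    = λ where
          (inj₁ 1<p)      p<q → inj₁ (ℚP.<-trans 1<p p<q)
          (inj₂ (y , yp)) p<q → inj₂ (y , ℝ.upward (value (f y)) yp p<q)
      ; open-     = λ where
          (inj₁ 1<q)      → let m , 1<m , m<q = ℚP.<-dense 1<q in m , m<q , inj₁ 1<m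
          (inj₂ (y , yq)) → let r , r<q , yr = ℝ.open- (value (f y)) yq
                            in r , r<q , inj₂ (y , yr)
      }
  ; 0≤value = nonneg
  ; value≤1 = λ _ → inj₁
  }
  where
    nonneg : ∀ q → 1ℚ ℚ.< q ⊎ (∃ λ y → Above (value (f y)) q) → 0ℚ ℚ.< q
    nonneg q (inj₁ 1<q)      = ℚP.<-trans (ℚP.positive⁻¹ 1ℚ) 1<q
    nonneg q (inj₂ (y , yq)) = 𝕀.0≤value (f y) q yq

-- A record rather than a plain definition so that α and β can be inferred.
infix 4 _⊑_
record _⊑_ {Z : Set} (α β : Z → 𝕀) : Set₁ where
  constructor mk⊑
  field
    modulus : ∀ (ε : ℝ) → 0ℝ < ε → Σ ℝ λ δ → 0ℝ < δ ×
                (∀ (z : Z) → value (α z) ≤ δ → value (β z) ≤ ε)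

-- Strict rational bounds: _⊏_ is equivalent to _⊑_ (⊑⇒⊏ and ⊏⇒⊑ below) and
-- only serves in proofs.
infix 4 _≺_ _⊏_
_≺_ : 𝕀 → ℚ → Set
a ≺ q = Above (value a) q

_⊏_ : {Z : Set} → (Z → 𝕀) → (Z → 𝕀) → Set
_⊏_ {Z} α β = ∀ (ε : ℚ) → 0ℚ ℚ.< ε → Σ ℚ λ δ → 0ℚ ℚ.< δ × δ ℚ.≤ 1ℚ ×
  (∀ (z : Z) → α z ≺ δ → β z ≺ ε)

≺-mono : ∀ (a : 𝕀) {p q} → a ≺ p → p ℚ.≤ q → a ≺ q
≺-mono a = Above-mono (value a)

min-bound : ∀ {p q} → 0ℚ ℚ.< p → 0ℚ ℚ.< q →
            Σ ℚ λ m → 0ℚ ℚ.< m × m ℚ.≤ p × m ℚ.≤ q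
min-bound {p} {q} 0<p 0<q with ℚP.≤-total p q
... | inj₁ p≤q = p , 0<p , ℚP.≤-refl , p≤q
... | inj₂ q≤p = q , 0<q , q≤p , ℚP.≤-refl

0<1 : 0ℚ ℚ.< 1ℚ
0<1 = ℚP.positive⁻¹ 1ℚ

⊑⇒⊏ : {Z : Set} {α β : Z → 𝕀} → α ⊑ β → α ⊏ β
⊑⇒⊏ {_} {α} {β} α⊑β ε 0<ε =
  case ℚP.<-dense 0<ε of λ (ε′ , 0<ε′ , ε′<ε) →
  case _⊑_.modulus α⊑β (fromℚ ε′) (ε′ , 0<ε′ , ℚP.<-irrefl refl) of λ (δ , (q , 0<q , ¬δq) , h) →
  case min-bound 0<q 0<1 of λ (m , 0<m , m≤q , m≤1) →
     m , 0<m , m≤1 , λ z αm →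
       h z (λ r δr → ℝ.upward (value (α z)) (≺-mono (α z) αm m≤q) (not-Above⇒< δ ¬δq δr))
         ε ε′<ε

⊏⇒⊑ : {Z : Set} {α β : Z → 𝕀} → α ⊏ β → α ⊑ β
⊏⇒⊑ {_} {α} {β} α⊏β = mk⊑ λ ε (q , 0<q , ¬εq) →
  case α⊏β q 0<q of λ (δ , 0<δ , _ , h) →
  case ℚP.<-dense 0<δ of λ (δ′ , 0<δ′ , δ′<δ) →
     fromℚ δ′ , (δ′ , 0<δ′ , ℚP.<-irrefl refl) , λ z α≤δ′ r εr →
       ℝ.upward (value (β z)) (h z (α≤δ′ δ δ′<δ)) (not-Above⇒< ε ¬εq εr)

inf-≺ : {Y : Set} (f : Y → 𝕀) {q : ℚ} → q ℚ.≤ 1ℚ → inf f ≺ q → ∃ λ y → f y ≺ q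
inf-≺ f q≤1 (inj₁ 1<q) = ⊥-elim (ℚP.<-irrefl refl (ℚP.<-≤-trans 1<q q≤1))
inf-≺ f q≤1 (inj₂ p)   = p

inf≃0⇒ : {Y : Set} (f : Y → 𝕀) → inf f ≃ᵢ 0ᵢ → ∀ q → 0ℚ ℚ.< q → ∃ λ y → f y ≺ q
inf≃0⇒ f (inf≤0 , _) q 0<q =
  case min-bound 0<q 0<1 of λ (m , 0<m , m≤q , m≤1) →
  case inf-≺ f m≤1 (inf≤0 m 0<m) of λ (y , ym) →
     y , ≺-mono (f y) ym m≤q

⇒inf≃0 : {Y : Set} (f : Y → 𝕀) → (∀ q → 0ℚ ℚ.< q → ∃ λ y → f y ≺ q) → inf f ≃ᵢ 0ᵢ
⇒inf≃0 f h = (λ q 0<q → inj₂ (h q 0<q)) , 𝕀.0≤value (inf f)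

inf-cong : {Y : Set} {f g : Y → 𝕀} → (∀ y → f y ≃ᵢ g y) → inf f ≃ᵢ inf g
inf-cong {Y} {f} {g} e = half f g (λ y → proj₁ (e y)) , half g f (λ y → proj₂ (e y))
  where
    half : (f g : Y → 𝕀) → (∀ y → value (f y) ≤ value (g y)) → value (inf f) ≤ value (inf g)
    half f g e q (inj₁ 1<q)      = inj₁ 1<q
    half f g e q (inj₂ (y , gy)) = inj₂ (y , e y q gy)

∨-cong : ∀ {a a′ b b′} → a ≃ᵢ a′ → b ≃ᵢ b′ → a ∨ b ≃ᵢ a′ ∨ b′
∨-cong (p , p′) (r , r′) =
  (λ q (x , y) → p q x , r q y) , (λ q (x , y) → p′ q x , r′ q y)

-- Sets are setoids, and functions on them respect the equality; here and for
-- metric spaces below.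
record ERObj : Set₁ where
  field
    set : Setoid 0ℓ 0ℓ
  open Setoid set public using (Carrier) renaming (_≈_ to _≈ₓ_)
  field
    R       : Carrier → Carrier → 𝕀
    R-cong  : ∀ {x x′ y y′} → x ≈ₓ x′ → y ≈ₓ y′ → R x y ≃ᵢ R x′ y′
    R-refl  : ∀ x → R x x ≃ᵢ 0ᵢ
    R-sym   : _⊑_ {Carrier × Carrier} (λ (x , y) → R x y) (λ (x , y) → R y x)
    R-trans : _⊑_ {Carrier × Carrier × Carrier}
                (λ (x , y , z) → R x y ∨ R y z) (λ (x , y , z) → R x z)

  R-refl≺ : ∀ x {q} → 0ℚ ℚ.< q → R x x ≺ q
  R-refl≺ x {q} = proj₁ (R-refl x) q

record FunctionalRelation (A B : ERObj) : Set₁ where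
  private
    module A = ERObj A
    module B = ERObj B
  field
    F             : A.Carrier → B.Carrier → 𝕀
    F-cong        : ∀ {x x′ y y′} → x A.≈ₓ x′ → y B.≈ₓ y′ → F x y ≃ᵢ F x′ y′
    extensional   : _⊑_ {A.Carrier × A.Carrier × B.Carrier × B.Carrier}
                      (λ (x , x′ , y , y′) → F x y ∨ A.R x x′ ∨ B.R y y′)
                      (λ (x , x′ , y , y′) → F x′ y′)
    single-valued : _⊑_ {A.Carrier × B.Carrier × B.Carrier}
                      (λ (x , y , y′) → F x y ∨ F x y′)
                      (λ (x , y , y′) → B.R y y′)
    total         : ∀ x → inf (λ y → F x y) ≃ᵢ 0ᵢ

-- One inequality suffices: it is symmetric on functional relations (∼-sym).
infix 4 _∼_
record _∼_ {A B : ERObj} (𝑭 𝑭′ : FunctionalRelation A B) : Set₁ where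
  constructor mk∼
  private
    module 𝑭  = FunctionalRelation 𝑭
    module 𝑭′ = FunctionalRelation 𝑭′
  field
    rel⊑ : _⊑_ {ERObj.Carrier A × ERObj.Carrier B}
             (λ (x , y) → 𝑭.F x y) (λ (x , y) → 𝑭′.F x y)

module _ (A : ERObj) where
  open ERObj A

  identityRelation : FunctionalRelation A A
  identityRelation = record
    { F             = R
    ; F-cong        = R-cong
    ; extensional   = ⊏⇒⊑ λ ε 0<ε →
        case ⊑⇒⊏ R-trans ε 0<ε of λ (δ₁ , 0<δ₁ , _ , tr₁) →
        case ⊑⇒⊏ R-trans δ₁ 0<δ₁ of λ (δ₂ , 0<δ₂ , _ , tr₂) →
        case ⊑⇒⊏ R-sym δ₂ 0<δ₂ of λ (δ₃ , 0<δ₃ , _ , sy) →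
        case min-bound 0<δ₁ 0<δ₂ of λ (m₁ , 0<m₁ , m₁≤δ₁ , m₁≤δ₂) →
        case min-bound 0<m₁ 0<δ₃ of λ (m , 0<m , m≤m₁ , m≤δ₃) →
        case min-bound 0<m 0<1 of λ (m′ , 0<m′ , m′≤m , m′≤1) →
        let m′≤m₁ = ℚP.≤-trans m′≤m m≤m₁ in
           m′ , 0<m′ , m′≤1 , λ (x , x′ , y , y′) ((xy , xx′) , yy′) →
             tr₁ (x′ , y , y′)
               ( tr₂ (x′ , x , y)
                   ( sy (x , x′) (≺-mono (R x x′) xx′ (ℚP.≤-trans m′≤m m≤δ₃))
                   , ≺-mono (R x y) xy (ℚP.≤-trans m′≤m₁ m₁≤δ₂))
               , ≺-mono (R y y′) yy′ (ℚP.≤-trans m′≤m₁ m₁≤δ₁))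
    ; single-valued = ⊏⇒⊑ λ ε 0<ε →
        case ⊑⇒⊏ R-trans ε 0<ε of λ (δ₁ , 0<δ₁ , _ , tr) →
        case ⊑⇒⊏ R-sym δ₁ 0<δ₁ of λ (δ₂ , 0<δ₂ , _ , sy) →
        case min-bound 0<δ₁ 0<δ₂ of λ (m , 0<m , m≤δ₁ , m≤δ₂) →
        case min-bound 0<m 0<1 of λ (m′ , 0<m′ , m′≤m , m′≤1) →
           m′ , 0<m′ , m′≤1 , λ (x , y , y′) (xy , xy′) →
             tr (y , x , y′)
               ( sy (x , y) (≺-mono (R x y) xy (ℚP.≤-trans m′≤m m≤δ₂))
               , ≺-mono (R x y′) xy′ (ℚP.≤-trans m′≤m m≤δ₁))
    ; total         = λ x → ⇒inf≃0 (R x) λ q 0<q → x , R-refl≺ x 0<q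
    }

module _ {A B C : ERObj} (𝑭 : FunctionalRelation A B) (𝑯 : FunctionalRelation B C) where
  private
    module A = ERObj A
    module B = ERObj B
    module C = ERObj C
    module 𝑭 = FunctionalRelation 𝑭
    module 𝑯 = FunctionalRelation 𝑯

  compositeRelation : FunctionalRelation A C
  compositeRelation = record
    { F             = λ x z → inf λ y → 𝑭.F x y ∨ 𝑯.F y z
    ; F-cong        = λ {x} {x′} {z} {z′} xx′ zz′ →
        inf-cong {f = λ y → 𝑭.F x y ∨ 𝑯.F y z} {g = λ y → 𝑭.F x′ y ∨ 𝑯.F y z′} λ y →
        ∨-cong {𝑭.F x y} {𝑭.F x′ y} {𝑯.F y z} {𝑯.F y z′}
          (𝑭.F-cong xx′ (Setoid.refl B.set)) (𝑯.F-cong (Setoid.refl B.set) zz′)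
    ; extensional   = ⊏⇒⊑ λ ε 0<ε →
        case ⊑⇒⊏ 𝑭.extensional ε 0<ε of λ (δ₁ , 0<δ₁ , δ₁≤1 , f) →
        case ⊑⇒⊏ 𝑯.extensional ε 0<ε of λ (δ₂ , 0<δ₂ , _ , h) →
        case min-bound 0<δ₁ 0<δ₂ of λ (m , 0<m , m≤δ₁ , m≤δ₂) →
        let m≤1 = ℚP.≤-trans m≤δ₁ δ₁≤1 in
           m , 0<m , m≤1 , λ (x , x′ , z , z′) ((xz , xx′) , zz′) →
             case inf-≺ (λ y → 𝑭.F x y ∨ 𝑯.F y z) m≤1 xz of λ (y , xy , yz) →
                inj₂ ( y
                     , f (x , x′ , y , y)
                         ( (≺-mono (𝑭.F x y) xy m≤δ₁ , ≺-mono (A.R x x′) xx′ m≤δ₁)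
                         , B.R-refl≺ y 0<δ₁)
                     , h (y , y , z , z′)
                         ( (≺-mono (𝑯.F y z) yz m≤δ₂ , B.R-refl≺ y 0<δ₂)
                         , ≺-mono (C.R z z′) zz′ m≤δ₂))
    ; single-valued = ⊏⇒⊑ λ ε 0<ε →
        case ⊑⇒⊏ 𝑯.single-valued ε 0<ε of λ (δ₁ , 0<δ₁ , δ₁≤1 , h) →
        case ⊑⇒⊏ 𝑯.extensional δ₁ 0<δ₁ of λ (δ₂ , 0<δ₂ , _ , e) →
        case ⊑⇒⊏ 𝑭.single-valued δ₂ 0<δ₂ of λ (δ₃ , 0<δ₃ , _ , f) →
        case min-bound 0<δ₁ 0<δ₂ of λ (m₁ , 0<m₁ , m₁≤δ₁ , m₁≤δ₂) →
        case min-bound 0<m₁ 0<δ₃ of λ (m , 0<m , m≤m₁ , m≤δ₃) →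
        let m≤δ₁ = ℚP.≤-trans m≤m₁ m₁≤δ₁ in
        let m≤δ₂ = ℚP.≤-trans m≤m₁ m₁≤δ₂ in
        let m≤1 = ℚP.≤-trans m≤δ₁ δ₁≤1 in
           m , 0<m , m≤1 , λ (x , z , z′) (xz , xz′) →
             case inf-≺ (λ y → 𝑭.F x y ∨ 𝑯.F y z)  m≤1 xz of λ (y , xy , yz) →
             case inf-≺ (λ y → 𝑭.F x y ∨ 𝑯.F y z′) m≤1 xz′ of λ (y′ , xy′ , y′z′) →
             let yy′ = f (x , y , y′) ( ≺-mono (𝑭.F x y) xy m≤δ₃
                                      , ≺-mono (𝑭.F x y′) xy′ m≤δ₃) in
             let y′z = e (y , y′ , z , z) ( (≺-mono (𝑯.F y z) yz m≤δ₂ , yy′)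
                                          , C.R-refl≺ z 0<δ₂) in
                h (y′ , z , z′) (y′z , ≺-mono (𝑯.F y′ z′) y′z′ m≤δ₁)
    ; total         = λ x → ⇒inf≃0 (λ z → inf λ y → 𝑭.F x y ∨ 𝑯.F y z) λ q 0<q →
        case inf≃0⇒ (𝑭.F x) (𝑭.total x) q 0<q of λ (y , xy) →
        case inf≃0⇒ (𝑯.F y) (𝑯.total y) q 0<q of λ (z , yz) →
           z , inj₂ (y , xy , yz)
    }

⊑-refl : {Z : Set} {α : Z → 𝕀} → α ⊑ α
⊑-refl = mk⊑ λ ε 0<ε → ε , 0<ε , λ _ p → p

⊑-trans : {Z : Set} {α β γ : Z → 𝕀} → α ⊑ β → β ⊑ γ → α ⊑ γ
⊑-trans (mk⊑ p) (mk⊑ r) = mk⊑ λ ε 0<ε →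
  case r ε 0<ε of λ (δ , 0<δ , h) →
  case p δ 0<δ of λ (η , 0<η , h′) →
     η , 0<η , λ z αz → h z (h′ z αz)

∼-sym : ∀ {A B} {F F′ : FunctionalRelation A B} → F ∼ F′ → F′ ∼ F
∼-sym {A} {B} {𝑭} {𝑭′} (mk∼ F∼F′) = mk∼ (⊏⇒⊑ λ ε 0<ε →
  case ⊑⇒⊏ 𝑭.extensional ε 0<ε of λ (δ₁ , 0<δ₁ , δ₁≤1 , e) →
  case ⊑⇒⊏ 𝑭′.single-valued δ₁ 0<δ₁ of λ (δ₂ , 0<δ₂ , δ₂≤1 , s) →
  case ⊑⇒⊏ F∼F′ δ₂ 0<δ₂ of λ (δ₃ , 0<δ₃ , _ , i) →
  case min-bound 0<δ₁ 0<δ₃ of λ (m , 0<m , m≤δ₁ , m≤δ₃) →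
     δ₂ , 0<δ₂ , δ₂≤1 , λ (x , y) xy →
       case inf≃0⇒ (𝑭.F x) (𝑭.total x) m 0<m of λ (y′ , xy′) →
       let y′y = s (x , y′ , y) (i (x , y′) (≺-mono (𝑭.F x y′) xy′ m≤δ₃) , xy) in
          e (x , x , y′ , y)
            ((≺-mono (𝑭.F x y′) xy′ m≤δ₁ , A.R-refl≺ x 0<δ₁) , y′y))
  where
    module A = ERObj A
    module 𝑭 = FunctionalRelation 𝑭
    module 𝑭′ = FunctionalRelation 𝑭′

ER : Category (lsuc 0ℓ) (lsuc 0ℓ) (lsuc 0ℓ)
ER = record
  { Obj       = ERObj
  ; _⇒_       = FunctionalRelation
  ; _≈_       = _∼_
  ; id        = λ {A} → identityRelation A
  ; _∘_       = λ H F → compositeRelation F H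
  ; equiv     = record
      { refl  = mk∼ ⊑-refl
      ; sym   = ∼-sym
      ; trans = λ (mk∼ p) (mk∼ r) → mk∼ (⊑-trans p r)
      }
  ; ∘-cong    = λ {_} {_} {_} {H} {H′} {F} {F′} (mk∼ H∼H′) (mk∼ F∼F′) → mk∼ (⊏⇒⊑ λ ε 0<ε →
      case ⊑⇒⊏ H∼H′ ε 0<ε of λ (δ₁ , 0<δ₁ , δ₁≤1 , h) →
      case ⊑⇒⊏ F∼F′ ε 0<ε of λ (δ₂ , 0<δ₂ , _ , f) →
      case min-bound 0<δ₁ 0<δ₂ of λ (m , 0<m , m≤δ₁ , m≤δ₂) →
      let m≤1 = ℚP.≤-trans m≤δ₁ δ₁≤1 in
         m , 0<m , m≤1 , λ (x , z) xz →
           case inf-≺ (λ y → rel F x y ∨ rel H y z) m≤1 xz of λ (y , xy , yz) →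
              inj₂ ( y , f (x , y) (≺-mono (rel F x y) xy m≤δ₂)
                       , h (y , z) (≺-mono (rel H y z) yz m≤δ₁)))
  ; assoc     = λ F G H → mk∼ (⊏⇒⊑ λ ε 0<ε →
      case min-bound 0<ε 0<1 of λ (m , 0<m , m≤ε , m≤1) →
         m , 0<m , m≤1 , λ (x , w) xw →
           case inf-≺ (λ y → rel F x y ∨ inf (λ z → rel G y z ∨ rel H z w)) m≤1 xw of λ (y , xy , yw) →
           case inf-≺ (λ z → rel G y z ∨ rel H z w) m≤1 yw of λ (z , yz , zw) →
              inj₂ ( z , inj₂ ( y , ≺-mono (rel F x y) xy m≤ε
                                  , ≺-mono (rel G y z) yz m≤ε)
                       , ≺-mono (rel H z w) zw m≤ε))
  ; identityˡ = λ {A} {B} F → mk∼ (⊏⇒⊑ λ ε 0<ε →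
      case ⊑⇒⊏ (FunctionalRelation.extensional F) ε 0<ε of λ (δ , 0<δ , δ≤1 , e) →
         δ , 0<δ , δ≤1 , λ (x , y) xy →
           case inf-≺ (λ y′ → rel F x y′ ∨ ERObj.R B y′ y) δ≤1 xy of λ (y′ , xy′ , y′y) →
              e (x , x , y′ , y) ((xy′ , ERObj.R-refl≺ A x 0<δ) , y′y))
  ; identityʳ = λ {A} {B} F → mk∼ (⊏⇒⊑ λ ε 0<ε →
      case ⊑⇒⊏ (FunctionalRelation.extensional F) ε 0<ε of λ (δ , 0<δ , _ , e) →
      case ⊑⇒⊏ (ERObj.R-sym A) δ 0<δ of λ (δ′ , 0<δ′ , _ , s) →
      case min-bound 0<δ 0<δ′ of λ (m , 0<m , m≤δ , m≤δ′) →
      case min-bound 0<m 0<1 of λ (m′ , 0<m′ , m′≤m , m′≤1) →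
         m′ , 0<m′ , m′≤1 , λ (x , y) xy →
           case inf-≺ (λ x′ → ERObj.R A x x′ ∨ rel F x′ y) m′≤1 xy of λ (x′ , xx′ , x′y) →
              e (x′ , x , y , y)
                ( ( ≺-mono (rel F x′ y) x′y (ℚP.≤-trans m′≤m m≤δ)
                  , s (x , x′) (≺-mono (ERObj.R A x x′) xx′ (ℚP.≤-trans m′≤m m≤δ′)))
                , ERObj.R-refl≺ B y 0<δ))
  }
  where
    rel = FunctionalRelation.F

record MetricSpace : Set₁ where
  field
    set : Setoid 0ℓ 0ℓ
  open Setoid set public using (Carrier) renaming (_≈_ to _≈ₓ_)
  field
    d          : Carrier → Carrier → ℝ
    d-cong     : ∀ {x x′ y y′} → x ≈ₓ x′ → y ≈ₓ y′ → d x y ≃ d x′ y′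
    d-nonneg   : ∀ x y → 0ℝ ≤ d x y
    d-refl     : ∀ x → d x x ≃ 0ℝ
    d-separate : ∀ x y → d x y ≃ 0ℝ → x ≈ₓ y
    d-sym      : ∀ x y → d x y ≃ d y x
    d-triangle : ∀ x y z → d x z ≤ d x y + d y z

module _ (M : MetricSpace) where
  open MetricSpace M

  IsCauchy : (ℕ → Carrier) → Set₁
  IsCauchy s = ∀ (ε : ℝ) → 0ℝ < ε →
    ∃ λ N → ∀ m n → N ℕ.≤ m → N ℕ.≤ n → d (s m) (s n) ≤ ε

  ConvergesTo : (ℕ → Carrier) → Carrier → Set₁
  ConvergesTo s x = ∀ (ε : ℝ) → 0ℝ < ε →
    ∃ λ N → ∀ n → N ℕ.≤ n → d (s n) x ≤ ε

  IsComplete : Set₁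
  IsComplete = ∀ s → IsCauchy s → ∃ λ x → ConvergesTo s x

record CompleteMetricSpace₁ : Set₁ where
  field
    space    : MetricSpace
    complete : IsComplete space
  open MetricSpace space public
  field
    d≤1      : ∀ x y → d x y ≤ 1ℝ

record UniformlyContinuousMap (A B : CompleteMetricSpace₁) : Set₁ where
  private
    module A = CompleteMetricSpace₁ A
    module B = CompleteMetricSpace₁ B
  field
    map      : A.Carrier → B.Carrier
    map-cong : ∀ {x x′} → x A.≈ₓ x′ → map x B.≈ₓ map x′
    uniform  : ∀ (ε : ℝ) → 0ℝ < ε → Σ ℝ λ δ → 0ℝ < δ ×
                (∀ x x′ → A.d x x′ ≤ δ → B.d (map x) (map x′) ≤ ε)

cMet₁ : Category (lsuc 0ℓ) (lsuc 0ℓ) 0ℓ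
cMet₁ = record
  { Obj       = CompleteMetricSpace₁
  ; _⇒_       = UniformlyContinuousMap
  ; _≈_       = λ {A} {B} f g → ∀ x → CompleteMetricSpace₁._≈ₓ_ B (map f x) (map g x)
  ; id        = record { map = λ x → x ; map-cong = λ p → p
                       ; uniform = λ ε 0<ε → ε , 0<ε , λ _ _ p → p }
  ; _∘_       = λ g f → record
      { map      = λ x → map g (map f x)
      ; map-cong = λ p → map-cong g (map-cong f p)
      ; uniform  = λ ε 0<ε →
          case uniform g ε 0<ε of λ (δ , 0<δ , h) →
          case uniform f δ 0<δ of λ (η , 0<η , h′) →
             η , 0<η , λ x x′ p → h _ _ (h′ x x′ p)
      }
  ; equiv     = λ {A} {B} → let module B = Setoid (CompleteMetricSpace₁.set B) in record
      { refl  = λ _ → B.refl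
      ; sym   = λ p x → B.sym (p x)
      ; trans = λ p r x → B.trans (p x) (r x) }
  ; ∘-cong    = λ {A} {B} {C} {g} {g′} {f} {f′} p r x →
      Setoid.trans (CompleteMetricSpace₁.set C) (map-cong g (r x)) (p (map f′ x))
  ; assoc     = λ {A} {B} {C} {D} _ _ _ _ → Setoid.refl (CompleteMetricSpace₁.set D)
  ; identityˡ = λ {A} {B} _ _ → Setoid.refl (CompleteMetricSpace₁.set B)
  ; identityʳ = λ {A} {B} _ _ → Setoid.refl (CompleteMetricSpace₁.set B)
  }
  where open UniformlyContinuousMap

halve : ∀ ε → 0ℚ ℚ.< ε → Σ ℚ λ δ → 0ℚ ℚ.< δ × δ ℚ.≤ 1ℚ × δ ℚ.+ δ ℚ.< ε
halve ε 0<ε =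
  case ℚP.<-dense 0<ε of λ (ε′ , 0<ε′ , ε′<ε) →
  let h = ½ ℚ.* ε′ in
  let 0<h = subst (ℚ._< h) (ℚP.*-zeroʳ ½) (ℚP.*-monoʳ-<-pos ½ 0<ε′) in
  let h+h≡ε′ = trans (sym (ℚP.*-distribʳ-+ ε′ ½ ½)) (ℚP.*-identityˡ ε′) in
  case min-bound 0<h 0<1 of λ (m , 0<m , m≤h , m≤1) →
     m , 0<m , m≤1
     , ℚP.≤-<-trans (ℚP.+-mono-≤ m≤h m≤h) (subst (ℚ._< ε) (sym h+h≡ε′) ε′<ε)

G₀ : CompleteMetricSpace₁ → ERObj
G₀ A = record
  { set     = set
  ; R       = λ x y → mk𝕀 (d x y) (d-nonneg x y) (d≤1 x y)
  ; R-cong  = d-cong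
  ; R-refl  = d-refl
  ; R-sym   = mk⊑ λ ε 0<ε → ε , 0<ε , λ (x , y) xy≤ε q εq → proj₁ (d-sym y x) q (xy≤ε q εq)
  ; R-trans = ⊏⇒⊑ λ ε 0<ε →
      case halve ε 0<ε of λ (δ , 0<δ , δ≤1 , δ+δ<ε) →
         δ , 0<δ , δ≤1 , λ (x , y , z) (xy , yz) →
           d-triangle x y z ε (δ , δ , xy , yz , δ+δ<ε)
  }
  where open CompleteMetricSpace₁ A

module _ {A B : CompleteMetricSpace₁} (f : UniformlyContinuousMap A B) where
  private
    module A = CompleteMetricSpace₁ A
    module B = CompleteMetricSpace₁ B
    module I = FunctionalRelation (identityRelation (G₀ B))
  open UniformlyContinuousMap f

  private
    uniform⊑ : _⊑_ {A.Carrier × A.Carrier} (λ (x , x′) → ERObj.R (G₀ A) x x′)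
                 (λ (x , x′) → ERObj.R (G₀ B) (map x) (map x′))
    uniform⊑ = mk⊑ λ ε 0<ε → let δ , 0<δ , h = uniform ε 0<ε in δ , 0<δ , λ (x , x′) → h x x′

  G₁ : FunctionalRelation (G₀ A) (G₀ B)
  G₁ = record
    { F             = λ x y → ERObj.R (G₀ B) (map x) y
    ; F-cong        = λ xx′ yy′ → B.d-cong (map-cong xx′) yy′
    ; extensional   = ⊏⇒⊑ λ ε 0<ε →
        case ⊑⇒⊏ I.extensional ε 0<ε of λ (δ₁ , 0<δ₁ , δ₁≤1 , e) →
        case ⊑⇒⊏ uniform⊑ δ₁ 0<δ₁ of λ (δ₂ , 0<δ₂ , _ , u) →
        case min-bound 0<δ₁ 0<δ₂ of λ (m , 0<m , m≤δ₁ , m≤δ₂) →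
           m , 0<m , ℚP.≤-trans m≤δ₁ δ₁≤1 , λ (x , x′ , y , y′) ((xy , xx′) , yy′) →
             e (map x , map x′ , y , y′)
               ( ( Above-mono (B.d (map x) y) xy m≤δ₁
                 , u (x , x′) (Above-mono (A.d x x′) xx′ m≤δ₂))
               , Above-mono (B.d y y′) yy′ m≤δ₁)
    ; single-valued = mk⊑ λ ε 0<ε →
        case _⊑_.modulus I.single-valued ε 0<ε of λ (δ , 0<δ , h) →
           δ , 0<δ , λ (x , y , y′) → h (map x , y , y′)
    ; total         = λ x → I.total (map x)
    }

G : Functor cMet₁ ER
G = record
  { F₀     = G₀
  ; F₁     = G₁
  ; F-cong = λ {A} {B} {f} {g} f≈g → mk∼ (mk⊑ λ ε 0<ε → ε , 0<ε , λ (x , y) fxy≤ε q εq →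
      proj₂ (CompleteMetricSpace₁.d-cong B (f≈g x) (Setoid.refl (CompleteMetricSpace₁.set B)))
        q (fxy≤ε q εq))
  ; F-id   = mk∼ ⊑-refl
  ; F-∘    = λ {A} {B} {C} f g → mk∼ (⊏⇒⊑ λ ε 0<ε →
      case min-bound 0<ε 0<1 of λ (m , 0<m , m≤ε , m≤1) →
         m , 0<m , m≤1 , λ (x , z) xz →
           let y = UniformlyContinuousMap.map f x in
           let gy = UniformlyContinuousMap.map g y in
              inj₂ ( y , ERObj.R-refl≺ (G₀ B) y 0<ε
                       , Above-mono (CompleteMetricSpace₁.d C gy z) xz m≤ε))
  }

{-# OPTIONS --safe #-}

-- G is full and faithful because a functional relation F between complete
-- spaces is the graph of a map: points yₙ with F(x, yₙ) < 2⁻ⁿ form a Cauchy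
-- sequence, whose limit is the value at x.  It is essentially surjective by
-- metrization and completion: the moduli of R give a countable base Vₙ of a
-- uniformity with five-fold composites of Vₙ₊₁ inside Vₙ.  It passes to the
-- set of rapidly converging sequences, where Frink's chain metric is complete,
-- and the constant sequences embed (X, R) densely, hence isomorphically.
module Submission where

open import Defs
open import Level using (_⊔_)
open import Function using (case_of_)
open import Data.Empty using (⊥-elim)
open import Data.Integer as ℤ using (+_; +[1+_])
open import Data.Nat as ℕ using (ℕ; zero; suc)
open import Data.Nat.Coprimality using (1-coprimeTo)
import Data.Nat.Properties as ℕP
open import Data.Product using (Σ; ∃; _×_; _,_; proj₁; proj₂)
open import Data.Rational as ℚ using (ℚ; mkℚ; 0ℚ; 1ℚ; ½)
import Data.Rational.Properties as ℚP
import Data.Rational.Unnormalised as ℚᵘ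
import Data.Rational.Unnormalised.Properties as ℚᵘP
open import Data.Unit using (⊤; tt)
open import Relation.Binary.Bundles using (Setoid)
open import Relation.Binary.Construct.Closure.ReflexiveTransitive using (Star; _◅_; _◅◅_) renaming (ε to [])
open import Relation.Binary.PropositionalEquality using (_≡_; refl; sym; trans; cong; subst; module ≡-Reasoning)
import Relation.Binary.Reasoning.Setoid as SetoidReasoning
open import Relation.Nullary using (¬_; yes; no)

-- Rational arithmetic

+-cancelˡ-< : ∀ p {q r} → p ℚ.+ q ℚ.< p ℚ.+ r → q ℚ.< r
+-cancelˡ-< p {q} {r} p+q<p+r with q ℚP.<? r
... | yes q<r = q<r
... | no  q≮r = ⊥-elim (ℚP.<-irrefl refl (ℚP.<-≤-trans p+q<p+r (ℚP.+-monoʳ-≤ p (ℚP.≮⇒≥ q≮r))))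

p+[q-p]≡q : ∀ p q → p ℚ.+ (q ℚ.- p) ≡ q
p+[q-p]≡q p q = begin
  p ℚ.+ (q ℚ.- p)      ≡⟨ cong (p ℚ.+_) (ℚP.+-comm q (ℚ.- p)) ⟩
  p ℚ.+ (ℚ.- p ℚ.+ q)  ≡⟨ ℚP.+-assoc p (ℚ.- p) q ⟨
  p ℚ.- p ℚ.+ q        ≡⟨ cong (ℚ._+ q) (ℚP.+-inverseʳ p) ⟩
  0ℚ ℚ.+ q             ≡⟨ ℚP.+-identityˡ q ⟩
  q                    ∎
  where open ≡-Reasoning

p+q<r⇒q<r-p : ∀ {p q r} → p ℚ.+ q ℚ.< r → q ℚ.< r ℚ.- p
p+q<r⇒q<r-p {p} {q} {r} p+q<r =
  +-cancelˡ-< p (subst (p ℚ.+ q ℚ.<_) (sym (p+[q-p]≡q p r)) p+q<r)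

q<r-p⇒p+q<r : ∀ {p q r} → q ℚ.< r ℚ.- p → p ℚ.+ q ℚ.< r
q<r-p⇒p+q<r {p} {q} {r} q<r-p =
  subst (p ℚ.+ q ℚ.<_) (p+[q-p]≡q p r) (ℚP.+-monoʳ-< p q<r-p)

p<q⇒0<q-p : ∀ {p q} → p ℚ.< q → 0ℚ ℚ.< q ℚ.- p
p<q⇒0<q-p {p} {q} p<q = p+q<r⇒q<r-p (subst (ℚ._< q) (sym (ℚP.+-identityʳ p)) p<q)

-- Written in lowest terms by hand, so that comparisons reduce to inequalities between natural
-- numbers.
1/suc : ℕ → ℚ
1/suc n = mkℚ (+ 1) n (1-coprimeTo (suc n))

2^- : ℕ → ℚ
2^- zero    = 1ℚ
2^- (suc n) = ½ ℚ.* 2^- n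

2^-suc+2^-suc : ∀ n → 2^- (suc n) ℚ.+ 2^- (suc n) ≡ 2^- n
2^-suc+2^-suc n = trans (sym (ℚP.*-distribʳ-+ (2^- n) ½ ½)) (ℚP.*-identityˡ (2^- n))

2^-pos : ∀ n → 0ℚ ℚ.< 2^- n
2^-pos zero    = ℚP.positive⁻¹ 1ℚ
2^-pos (suc n) = subst (ℚ._< 2^- (suc n)) (ℚP.*-zeroʳ ½) (ℚP.*-monoʳ-<-pos ½ (2^-pos n))

2^-suc< : ∀ n → 2^- (suc n) ℚ.< 2^- n
2^-suc< n = begin-strict
  2^- (suc n)                  ≡⟨ ℚP.+-identityʳ _ ⟨
  2^- (suc n) ℚ.+ 0ℚ           <⟨ ℚP.+-monoʳ-< (2^- (suc n)) (2^-pos (suc n)) ⟩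
  2^- (suc n) ℚ.+ 2^- (suc n)  ≡⟨ 2^-suc+2^-suc n ⟩
  2^- n                        ∎
  where open ℚP.≤-Reasoning

2^-antitone : ∀ {m n} → m ℕ.≤ n → 2^- n ℚ.≤ 2^- m
2^-antitone {m} m≤n = go (ℕP.≤⇒≤′ m≤n)
  where
    go : ∀ {n} → m ℕ.≤′ n → 2^- n ℚ.≤ 2^- m
    go (ℕ.≤′-reflexive refl) = ℚP.≤-refl
    go (ℕ.≤′-step {n} m≤′n)  = ℚP.≤-trans (ℚP.<⇒≤ (2^-suc< n)) (go m≤′n)

2^-cancel-< : ∀ {m n} → 2^- m ℚ.< 2^- n → n ℕ.< m
2^-cancel-< {m} {n} m<n with n ℕP.<? m
... | yes p = p
... | no  p = ⊥-elim (ℚP.<-irrefl refl (ℚP.<-≤-trans m<n (2^-antitone (ℕP.≮⇒≥ p))))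

2^-≤1/suc : ∀ n → 2^- n ℚ.≤ 1/suc n
2^-≤1/suc zero    = ℚP.≤-refl
2^-≤1/suc (suc n) = ℚP.≤-trans (ℚP.*-monoˡ-≤-nonNeg ½ (2^-≤1/suc n)) (ℚP.toℚᵘ-cancel-≤ (begin
  ℚ.toℚᵘ (½ ℚ.* 1/suc n)             ≃⟨ ℚP.toℚᵘ-homo-* ½ (1/suc n) ⟩
  ℚ.toℚᵘ ½ ℚᵘ.* ℚ.toℚᵘ (1/suc n)     ≤⟨ ℚᵘ.*≤* (ℤ.+≤+ (ℕ.s≤s bound)) ⟩
  ℚ.toℚᵘ (1/suc (suc n))             ∎))
  where
    open ℚᵘP.≤-Reasoning
    -- This is `n + 2 ≤ 2 (n + 1)`, the cross-multiplied form of `1/(2n+2) ≤ 1/(n+2)`, with one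
    -- successor removed on each side.
    bound : suc (n ℕ.+ 0) ℕ.≤ n ℕ.+ suc (n ℕ.+ 0) ℕ.+ 0
    bound = ℕP.≤-trans (ℕP.m≤n+m (suc (n ℕ.+ 0)) n) (ℕP.m≤m+n _ 0)

2^-archimedean : ∀ q → 0ℚ ℚ.< q → ∃ λ n → 2^- n ℚ.< q
2^-archimedean q@(mkℚ (+ 0) _ _) 0<q = ⊥-elim (ℚP.<-irrefl (sym (ℚP.↥p≡0⇒p≡0 q refl)) 0<q)
2^-archimedean (mkℚ ℤ.-[1+ _ ] _ _) (ℚ.*<* ())
2^-archimedean q@(mkℚ +[1+ k ] m _) 0<q =
  -- The field `m` is the denominator minus one, and the numerator is at least 1, so `q` is at least
  -- `1/suc m`. The extra successor makes the inequality strict.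
  suc m , ℚP.<-≤-trans (2^-suc< m) (ℚP.≤-trans (2^-≤1/suc m) 1/suc≤q)
  where
    1/suc≤q : 1/suc m ℚ.≤ q
    1/suc≤q = ℚ.*≤* (ℤ.+≤+ (ℕ.s≤s (ℕP.+-monoʳ-≤ m ℕ.z≤n)))

-- Categories

module _ {o h e} (C : Category o h e) where
  open Category C

  homSetoid : Obj → Obj → Setoid h e
  homSetoid A B = record { Carrier = A ⇒ B ; _≈_ = _≈_ ; isEquivalence = equiv }

  cancelInner : ∀ {A B D E} {f : A ⇒ B} {k : B ⇒ E} {g : B ⇒ D} {g⁻ : D ⇒ B} →
                g⁻ ∘ g ≈ id → (k ∘ g⁻) ∘ (g ∘ f) ≈ k ∘ f
  cancelInner {f = f} {k} {g} {g⁻} p = begin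
    (k ∘ g⁻) ∘ (g ∘ f)  ≈⟨ assoc (g ∘ f) g⁻ k ⟩
    k ∘ (g⁻ ∘ (g ∘ f))  ≈⟨ ∘-cong Equiv.refl (assoc f g g⁻) ⟨
    k ∘ ((g⁻ ∘ g) ∘ f)  ≈⟨ ∘-cong Equiv.refl (∘-cong p Equiv.refl) ⟩
    k ∘ (id ∘ f)        ≈⟨ ∘-cong Equiv.refl (identityˡ f) ⟩
    k ∘ f               ∎
    where open SetoidReasoning (homSetoid _ _)

  cancelLeft : ∀ {A B D} {f : A ⇒ B} {g : B ⇒ D} {g⁻ : D ⇒ B} →
               g⁻ ∘ g ≈ id → g⁻ ∘ (g ∘ f) ≈ f
  cancelLeft {f = f} {g} {g⁻} p = begin
    g⁻ ∘ (g ∘ f)  ≈⟨ assoc f g g⁻ ⟨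
    (g⁻ ∘ g) ∘ f  ≈⟨ ∘-cong p Equiv.refl ⟩
    id ∘ f        ≈⟨ identityˡ f ⟩
    f             ∎
    where open SetoidReasoning (homSetoid _ _)

record Isomorphism {o h e} (C : Category o h e) (A B : Category.Obj C) : Set (h ⊔ e) where
  open Category C
  field
    to      : A ⇒ B
    from    : B ⇒ A
    to∘from : to ∘ from ≈ id
    from∘to : from ∘ to ≈ id

module _ {o h e o′ h′ e′} {C : Category o h e} {D : Category o′ h′ e′} (F : Functor C D) where
  private
    module C = Category C
    module D = Category D
  open Functor F

  Full : Set _
  Full = ∀ {A B} (g : F₀ A D.⇒ F₀ B) → ∃ λ f → F₁ f D.≈ g

  Faithful : Set _
  Faithful = ∀ {A B} (f g : A C.⇒ B) → F₁ f D.≈ F₁ g → f C.≈ g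

  EssentiallySurjective : Set _
  EssentiallySurjective = ∀ B → ∃ λ A → Isomorphism D (F₀ A) B

  module _ (full : Full) (faithful : Faithful) (surjective : EssentiallySurjective) where
    private
      H₀ : D.Obj → C.Obj
      H₀ B = proj₁ (surjective B)

      module ι B = Isomorphism (proj₂ (surjective B))

      lift : ∀ {A B} → F₀ A D.⇒ F₀ B → A C.⇒ B
      lift g = proj₁ (full g)

      F-lift : ∀ {A B} (g : F₀ A D.⇒ F₀ B) → F₁ (lift g) D.≈ g
      F-lift g = proj₂ (full g)

      -- Transport along the chosen isomorphisms moves a morphism between objects in the image of
      -- `F`, where fullness can lift it.
      conj : ∀ {A B} → A D.⇒ B → F₀ (H₀ A) D.⇒ F₀ (H₀ B)
      conj {A} {B} g = (ι.from B D.∘ g) D.∘ ι.to A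

      F-lift-∘ : ∀ {A B E} (f : F₀ A D.⇒ F₀ B) (g : F₀ B D.⇒ F₀ E) →
                 F₁ (lift g C.∘ lift f) D.≈ g D.∘ f
      F-lift-∘ f g = D.Equiv.trans (F-∘ _ _) (D.∘-cong (F-lift g) (F-lift f))

      -- Every law in `C` is tested after applying `F`, by faithfulness, and `F-lift` then removes
      -- the lifts.
      H : Functor D C
      H = record
        { F₀     = H₀
        ; F₁     = λ g → lift (conj g)
        ; F-cong = λ {_} {_} {f} {g} p → faithful _ _ (begin
            F₁ (lift (conj f))  ≈⟨ F-lift _ ⟩
            conj f              ≈⟨ D.∘-cong (D.∘-cong D.Equiv.refl p) D.Equiv.refl ⟩
            conj g              ≈⟨ F-lift _ ⟨
            F₁ (lift (conj g))  ∎)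
        ; F-id   = λ {A} → faithful _ _ (begin
            F₁ (lift (conj D.id))               ≈⟨ F-lift _ ⟩
            (ι.from A D.∘ D.id) D.∘ ι.to A      ≈⟨ D.∘-cong (D.identityʳ _) D.Equiv.refl ⟩
            ι.from A D.∘ ι.to A                 ≈⟨ ι.from∘to A ⟩
            D.id                                ≈⟨ F-id ⟨
            F₁ C.id                             ∎)
        ; F-∘    = λ {A} {B} {E} f g → faithful _ _ (begin
            F₁ (lift (conj (g D.∘ f)))                    ≈⟨ F-lift _ ⟩
            (ι.from E D.∘ (g D.∘ f)) D.∘ ι.to A           ≈⟨ D.∘-cong (D.assoc f g _) D.Equiv.refl ⟨
            ((ι.from E D.∘ g) D.∘ f) D.∘ ι.to A           ≈⟨ D.assoc _ f _ ⟩
            (ι.from E D.∘ g) D.∘ (f D.∘ ι.to A)           ≈⟨ cancelInner D (ι.to∘from B) ⟨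
            conj g D.∘ (ι.from B D.∘ (f D.∘ ι.to A))      ≈⟨ D.∘-cong D.Equiv.refl (D.assoc _ f _) ⟨
            conj g D.∘ conj f                             ≈⟨ F-lift-∘ _ _ ⟨
            F₁ (lift (conj g) C.∘ lift (conj f))          ∎)
        }
        where open module R {A} {B} = SetoidReasoning (homSetoid D A B)

    fullyFaithful∧surjective⇒equivalence : IsEquivalenceOfCategories F
    fullyFaithful∧surjective⇒equivalence = record
      { inverse = H
      ; unit    = record
          -- The isomorphism chosen for `F₀ A` runs between two objects in the image of `F`, so it
          -- lifts to `C`.
          { to      = λ A → lift (ι.from (F₀ A))
          ; from    = λ A → lift (ι.to (F₀ A))
          ; natural = λ {A} {B} f → faithful _ _ (begin
              F₁ (lift (ι.from (F₀ B)) C.∘ f)            ≈⟨ F-∘ _ _ ⟩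
              F₁ (lift (ι.from (F₀ B))) D.∘ F₁ f         ≈⟨ D.∘-cong (F-lift _) D.Equiv.refl ⟩
              ι.from (F₀ B) D.∘ F₁ f                     ≈⟨ D.identityʳ _ ⟨
              -- The identity is expanded so that `conj (F₁ f)` appears.
              (ι.from (F₀ B) D.∘ F₁ f) D.∘ D.id          ≈⟨ D.∘-cong D.Equiv.refl (ι.to∘from _) ⟨
              (ι.from (F₀ B) D.∘ F₁ f) D.∘ (ι.to (F₀ A) D.∘ ι.from (F₀ A))  ≈⟨ D.assoc _ _ _ ⟨
              conj (F₁ f) D.∘ ι.from (F₀ A)              ≈⟨ F-lift-∘ _ _ ⟨
              F₁ (lift (conj (F₁ f)) C.∘ lift (ι.from (F₀ A)))  ∎)
          ; to∘from = λ A → faithful _ _ (begin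
              F₁ (lift (ι.from (F₀ A)) C.∘ lift (ι.to (F₀ A)))  ≈⟨ F-lift-∘ _ _ ⟩
              ι.from (F₀ A) D.∘ ι.to (F₀ A)                     ≈⟨ ι.from∘to _ ⟩
              D.id                                              ≈⟨ F-id ⟨
              F₁ C.id                                           ∎)
          ; from∘to = λ A → faithful _ _ (begin
              F₁ (lift (ι.to (F₀ A)) C.∘ lift (ι.from (F₀ A)))  ≈⟨ F-lift-∘ _ _ ⟩
              ι.to (F₀ A) D.∘ ι.from (F₀ A)                     ≈⟨ ι.to∘from _ ⟩
              D.id                                              ≈⟨ F-id ⟨
              F₁ C.id                                           ∎)
          }
      ; counit  = record
          { to      = ι.to
          ; from    = ι.from
          ; natural = λ {A} {B} g → begin
              ι.to B D.∘ F₁ (lift (conj g))                  ≈⟨ D.∘-cong D.Equiv.refl (F-lift _) ⟩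
              ι.to B D.∘ ((ι.from B D.∘ g) D.∘ ι.to A)       ≈⟨ D.∘-cong D.Equiv.refl (D.assoc _ g _) ⟩
              ι.to B D.∘ (ι.from B D.∘ (g D.∘ ι.to A))       ≈⟨ cancelLeft D (ι.to∘from B) ⟩
              g D.∘ ι.to A                                   ∎
          ; to∘from = ι.to∘from
          ; from∘to = ι.from∘to
          }
      }
      where open module R {A} {B} = SetoidReasoning (homSetoid D A B)

-- Complete metric spaces and functional relations

-- `¬ Above b q` means `q ≤ b`, so every rational above `b` exceeds `q`. This turns strict rational
-- estimates back into bounds by a real `ε`.
separated⇒≤ : ∀ {a b q} → Above a q → ¬ Above b q → a ≤ b
separated⇒≤ {a} {b} aq ¬bq r br = ℝ.upward a aq (not-Above⇒< b ¬bq br)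

0<fromℚ : ∀ {q} → 0ℚ ℚ.< q → 0ℝ < fromℚ q
0<fromℚ {q} 0<q = q , 0<q , ℚP.<-irrefl refl

module _ (M : MetricSpace) where
  open MetricSpace M

  cauchy⇒≺ : ∀ {s} → IsCauchy M s → ∀ q → 0ℚ ℚ.< q →
             ∃ λ N → ∀ m n → N ℕ.≤ m → N ℕ.≤ n → Above (d (s m) (s n)) q
  cauchy⇒≺ cauchy q 0<q =
    case ℚP.<-dense 0<q of λ (p , 0<p , p<q) →
    case cauchy (fromℚ p) (0<fromℚ 0<p) of λ (N , h) →
      N , λ m n N≤m N≤n → h m n N≤m N≤n q p<q

  ≺⇒cauchy : ∀ {s} → (∀ q → 0ℚ ℚ.< q →
               ∃ λ N → ∀ m n → N ℕ.≤ m → N ℕ.≤ n → Above (d (s m) (s n)) q) →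
             IsCauchy M s
  ≺⇒cauchy {s} h ε (q , 0<q , ¬εq) =
    case h q 0<q of λ (N , h′) →
      N , λ m n N≤m N≤n → separated⇒≤ {d (s m) (s n)} {ε} (h′ m n N≤m N≤n) ¬εq

  converges⇒≺ : ∀ {s x} → ConvergesTo M s x → ∀ q → 0ℚ ℚ.< q →
                ∃ λ N → ∀ n → N ℕ.≤ n → Above (d (s n) x) q
  converges⇒≺ conv q 0<q =
    case ℚP.<-dense 0<q of λ (p , 0<p , p<q) →
    case conv (fromℚ p) (0<fromℚ 0<p) of λ (N , h) →
      N , λ n N≤n → h n N≤n q p<q

  ≺⇒converges : ∀ {s x} → (∀ q → 0ℚ ℚ.< q → ∃ λ N → ∀ n → N ℕ.≤ n → Above (d (s n) x) q) →
                ConvergesTo M s x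
  ≺⇒converges {s} {x} h ε (q , 0<q , ¬εq) =
    case h q 0<q of λ (N , h′) →
      N , λ n N≤n → separated⇒≤ {d (s n) x} {ε} (h′ n N≤n) ¬εq

  indiscernible⇒≈ : ∀ x y → (∀ q → 0ℚ ℚ.< q → Above (d x y) q) → x ≈ₓ y
  indiscernible⇒≈ x y h = d-separate x y (h , d-nonneg x y)

module _ {A B : CompleteMetricSpace₁} (𝑭 : FunctionalRelation (G₀ A) (G₀ B)) where
  private
    module A = CompleteMetricSpace₁ A
    module B = CompleteMetricSpace₁ B
    module GA = ERObj (G₀ A)
    module GB = ERObj (G₀ B)
  open FunctionalRelation 𝑭

  private
    approx : ∀ x n → ∃ λ y → F x y ≺ 2^- n
    approx x n = inf≃0⇒ (F x) (total x) (2^- n) (2^-pos n)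

    value-at : A.Carrier → ℕ → B.Carrier
    value-at x n = proj₁ (approx x n)

    value-at≺ : ∀ x {n N q} → N ℕ.≤ n → 2^- N ℚ.< q → F x (value-at x n) ≺ q
    value-at≺ x {n} N≤n p =
      ≺-mono (F x _) (proj₂ (approx x n)) (ℚP.≤-trans (2^-antitone N≤n) (ℚP.<⇒≤ p))

    value-at-cauchy : ∀ x → IsCauchy B.space (value-at x)
    value-at-cauchy x = ≺⇒cauchy B.space λ q 0<q →
      case ⊑⇒⊏ single-valued q 0<q of λ (δ , 0<δ , _ , s) →
      case 2^-archimedean δ 0<δ of λ (N , N<δ) →
        N , λ m n N≤m N≤n → s (x , _ , _) (value-at≺ x N≤m N<δ , value-at≺ x N≤n N<δ)

    limit : ∀ x → ∃ λ y → ConvergesTo B.space (value-at x) y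
    limit x = B.complete (value-at x) (value-at-cauchy x)

    f : A.Carrier → B.Carrier
    f x = proj₁ (limit x)

    -- An approximant of index `M ⊔ N` is both nearly `F`-related to `x` and close to the limit;
    -- extensionality carries the relation over to the limit.
    F-graph : ∀ x {q} → 0ℚ ℚ.< q → F x (f x) ≺ q
    F-graph x {q} 0<q =
      case ⊑⇒⊏ extensional q 0<q of λ (δ , 0<δ , _ , e) →
      case converges⇒≺ B.space (proj₂ (limit x)) δ 0<δ of λ (M , h) →
      case 2^-archimedean δ 0<δ of λ (N , N<δ) →
        e (x , x , value-at x (M ℕ.⊔ N) , f x)
          ( (value-at≺ x (ℕP.m≤n⊔m M N) N<δ , GA.R-refl≺ x 0<δ)
          , h (M ℕ.⊔ N) (ℕP.m≤m⊔n M N))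

    -- If `x` is close to `x′`, extensionality makes `f x` an approximate value at `x′`, as `f x′`
    -- is; single-valuedness compares the two.
    f-uniform : _⊑_ {A.Carrier × A.Carrier} (λ (x , x′) → GA.R x x′) (λ (x , x′) → GB.R (f x) (f x′))
    f-uniform = ⊏⇒⊑ λ ε 0<ε →
      case ⊑⇒⊏ single-valued ε 0<ε of λ (δ₁ , 0<δ₁ , _ , s) →
      case ⊑⇒⊏ extensional δ₁ 0<δ₁ of λ (δ₂ , 0<δ₂ , δ₂≤1 , e) →
        δ₂ , 0<δ₂ , δ₂≤1 , λ (x , x′) xx′ →
          s (x′ , f x , f x′)
            ( e (x , x′ , f x , f x) ((F-graph x 0<δ₂ , xx′) , GB.R-refl≺ (f x) 0<δ₂)
            , F-graph x′ 0<δ₁)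

  functionalRelation⇒map : ∃ λ g → G₁ {A} {B} g ∼ 𝑭
  functionalRelation⇒map = record
    { map      = f
    -- The limits are chosen separately at each point. Equal points have distance zero, so
    -- uniformity puts the distance of their values below every `q`.
    ; map-cong = λ {x} {x′} x≈x′ → indiscernible⇒≈ B.space (f x) (f x′) λ q 0<q →
        case ⊑⇒⊏ f-uniform q 0<q of λ (δ , 0<δ , _ , u) →
          u (x , x′) (proj₁ (A.d-cong (Setoid.refl A.set) (Setoid.sym A.set x≈x′)) δ (GA.R-refl≺ x 0<δ))
    ; uniform  = λ ε 0<ε → case _⊑_.modulus f-uniform ε 0<ε of λ (δ , 0<δ , u) →
        δ , 0<δ , λ x x′ → u (x , x′)
    } , mk∼ (⊏⇒⊑ λ ε 0<ε →
      case ⊑⇒⊏ extensional ε 0<ε of λ (δ , 0<δ , δ≤1 , e) →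
        δ , 0<δ , δ≤1 , λ (x , y) fxy →
          e (x , x , f x , y) ((F-graph x 0<δ , GA.R-refl≺ x 0<δ) , fxy))

G-full : Full G
G-full {A} {B} = functionalRelation⇒map {A} {B}

-- At the point `(x, map f x)` the first graph vanishes, so the second one, the distance from
-- `map g x` to `map f x`, lies below every `q`.
G-faithful : Faithful G
G-faithful {A} {B} f g (mk∼ f∼g) x =
  Setoid.sym B.set (indiscernible⇒≈ B.space (map g x) (map f x) λ q 0<q →
    case ⊑⇒⊏ f∼g q 0<q of λ (δ , 0<δ , _ , h) →
      h (x , map f x) (ERObj.R-refl≺ (G₀ B) (map f x) 0<δ))
  where
    module B = CompleteMetricSpace₁ B
    open UniformlyContinuousMap

-- Dense embeddings and isomorphisms of ER(U)

module _ {A B : ERObj} (i : ERObj.Carrier A → ERObj.Carrier B) where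
  private
    module A = ERObj A
    module B = ERObj B
    module I = FunctionalRelation (identityRelation B)

  record IsDenseEmbedding : Set₁ where
    field
      i-cong    : ∀ {x y} → x A.≈ₓ y → i x B.≈ₓ i y
      preserves : _⊏_ {A.Carrier × A.Carrier} (λ (x , y) → A.R x y) (λ (x , y) → B.R (i x) (i y))
      reflects  : _⊏_ {A.Carrier × A.Carrier} (λ (x , y) → B.R (i x) (i y)) (λ (x , y) → A.R x y)
      dense     : ∀ y q → 0ℚ ℚ.< q → ∃ λ x → B.R y (i x) ≺ q

  module _ (isDense : IsDenseEmbedding) where
    open IsDenseEmbedding isDense

    private
      to : FunctionalRelation B A
      to = record
        { F             = λ y x → B.R y (i x)
        ; F-cong        = λ p r → B.R-cong p (i-cong r)
        ; extensional   = ⊏⇒⊑ λ ε 0<ε →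
            case ⊑⇒⊏ I.extensional ε 0<ε of λ (δ₁ , 0<δ₁ , δ₁≤1 , e) →
            case preserves δ₁ 0<δ₁ of λ (δ₂ , 0<δ₂ , _ , p) →
            case min-bound 0<δ₁ 0<δ₂ of λ (m , 0<m , m≤δ₁ , m≤δ₂) →
              m , 0<m , ℚP.≤-trans m≤δ₁ δ₁≤1 , λ (y , y′ , x , x′) ((yx , yy′) , xx′) →
                e (y , y′ , i x , i x′)
                  ( (≺-mono (B.R y (i x)) yx m≤δ₁ , ≺-mono (B.R y y′) yy′ m≤δ₁)
                  , p (x , x′) (≺-mono (A.R x x′) xx′ m≤δ₂))
        ; single-valued = ⊏⇒⊑ λ ε 0<ε →
            case reflects ε 0<ε of λ (δ₁ , 0<δ₁ , _ , r) →
            case ⊑⇒⊏ I.single-valued δ₁ 0<δ₁ of λ (δ₂ , 0<δ₂ , δ₂≤1 , s) →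
              δ₂ , 0<δ₂ , δ₂≤1 , λ (y , x , x′) p → r (x , x′) (s (y , i x , i x′) p)
        ; total         = λ y → ⇒inf≃0 (λ x → B.R y (i x)) (dense y)
        }

      from : FunctionalRelation A B
      from = record
        { F             = λ x y → B.R (i x) y
        ; F-cong        = λ p r → B.R-cong (i-cong p) r
        ; extensional   = ⊏⇒⊑ λ ε 0<ε →
            case ⊑⇒⊏ I.extensional ε 0<ε of λ (δ₁ , 0<δ₁ , δ₁≤1 , e) →
            case preserves δ₁ 0<δ₁ of λ (δ₂ , 0<δ₂ , _ , p) →
            case min-bound 0<δ₁ 0<δ₂ of λ (m , 0<m , m≤δ₁ , m≤δ₂) →
              m , 0<m , ℚP.≤-trans m≤δ₁ δ₁≤1 , λ (x , x′ , y , y′) ((xy , xx′) , yy′) →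
                e (i x , i x′ , y , y′)
                  ( ( ≺-mono (B.R (i x) y) xy m≤δ₁
                    , p (x , x′) (≺-mono (A.R x x′) xx′ m≤δ₂))
                  , ≺-mono (B.R y y′) yy′ m≤δ₁)
        ; single-valued = ⊏⇒⊑ λ ε 0<ε →
            case ⊑⇒⊏ I.single-valued ε 0<ε of λ (δ , 0<δ , δ≤1 , s) →
              δ , 0<δ , δ≤1 , λ (x , y , y′) → s (i x , y , y′)
        ; total         = λ x → I.total (i x)
        }

    -- A composite being small yields an intermediate point, and transitivity through it bounds the
    -- distance of the ends. On the side of `A` these ends are images under `i`, and `reflects`
    -- pulls the bound back.
    denseEmbedding⇒iso : Isomorphism ER B A
    denseEmbedding⇒iso = record
      { to      = to
      ; from    = from
      ; to∘from = mk∼ (⊏⇒⊑ λ ε 0<ε →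
          case reflects ε 0<ε of λ (δ₁ , 0<δ₁ , _ , r) →
          case ⊑⇒⊏ B.R-trans δ₁ 0<δ₁ of λ (δ₂ , 0<δ₂ , δ₂≤1 , t) →
            δ₂ , 0<δ₂ , δ₂≤1 , λ (x , x′) xx′ →
              case inf-≺ (λ y → B.R (i x) y ∨ B.R y (i x′)) δ₂≤1 xx′ of λ (y , p) →
                r (x , x′) (t (i x , y , i x′) p))
      ; from∘to = mk∼ (⊏⇒⊑ λ ε 0<ε →
          case ⊑⇒⊏ B.R-trans ε 0<ε of λ (δ , 0<δ , δ≤1 , t) →
            δ , 0<δ , δ≤1 , λ (y , y′) yy′ →
              case inf-≺ (λ x → B.R y (i x) ∨ B.R (i x) y′) δ≤1 yy′ of λ (x , p) →
                t (y , i x , y′) p)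
      }

-- Metrization of a countable uniformity

module Metrization
  {X : Set} (V : ℕ → X → X → Set)
  (V-refl : ∀ n x → V n x x)
  (V-sym  : ∀ {n x y} → V n x y → V n y x)
  (V-comp : ∀ {n x y z t} → V (suc n) x y → V (suc n) y z → V (suc n) z t → V n x t)
  where

  -- The trivial relation at level 0 keeps distances below 1.
  Link : ℕ → X → X → Set
  Link zero    _ _ = ⊤
  Link (suc n) x y = V n x y

  Link-refl : ∀ n x → Link n x x
  Link-refl zero    _ = tt
  Link-refl (suc n) x = V-refl n x

  Link-sym : ∀ n {x y} → Link n x y → Link n y x
  Link-sym zero    _ = tt
  Link-sym (suc n) v = V-sym v

  Link-comp : ∀ n {x y z t} → Link (suc n) x y → Link (suc n) y z → Link (suc n) z t → Link n x t
  Link-comp zero    _ _ _ = tt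
  Link-comp (suc n) u v w = V-comp u v w

  Link-antitone : ∀ {m n} → m ℕ.≤ n → ∀ {x y} → Link n x y → Link m x y
  Link-antitone {m} m≤n = go (ℕP.≤⇒≤′ m≤n)
    where
      go : ∀ {n} → m ℕ.≤′ n → ∀ {x y} → Link n x y → Link m x y
      go (ℕ.≤′-reflexive refl)    u = u
      go (ℕ.≤′-step {n} m≤′n) {y = y} u =
        go m≤′n (Link-comp n u (Link-refl (suc n) y) (Link-refl (suc n) y))

  Step : X → X → Set
  Step x y = ∃ λ n → Link n x y

  Chain : X → X → Set
  Chain = Star Step

  cost : ∀ {x y} → Step x y → ℚ
  cost (n , _) = 2^- n

  weight : ∀ {x y} → Chain x y → ℚ
  weight []       = 0ℚ
  weight (e ◅ c) = cost e ℚ.+ weight c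

  length : ∀ {x y} → Chain x y → ℕ
  length []       = 0
  length (_ ◅ c) = suc (length c)

  cost-pos : ∀ {x y} (e : Step x y) → 0ℚ ℚ.< cost e
  cost-pos (n , _) = 2^-pos n

  weight-nonneg : ∀ {x y} (c : Chain x y) → 0ℚ ℚ.≤ weight c
  weight-nonneg []       = ℚP.≤-refl
  weight-nonneg (e ◅ c) = ℚP.+-mono-≤ (ℚP.<⇒≤ (cost-pos e)) (weight-nonneg c)

  weight-◅◅ : ∀ {x y z} (c : Chain x y) (c′ : Chain y z) →
              weight (c ◅◅ c′) ≡ weight c ℚ.+ weight c′
  weight-◅◅ []       c′ = sym (ℚP.+-identityˡ (weight c′))
  weight-◅◅ (e ◅ c) c′ =
    trans (cong (cost e ℚ.+_) (weight-◅◅ c c′)) (sym (ℚP.+-assoc (cost e) (weight c) (weight c′)))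

  reversal : ∀ {x y} (c : Chain x y) → ∃ λ (c′ : Chain y x) → weight c′ ≡ weight c
  reversal [] = [] , refl
  reversal (e@(n , u) ◅ c) with reversal c
  ... | c′ , eq = c′ ◅◅ (n , Link-sym n u) ◅ [] , (begin
    weight (c′ ◅◅ (n , Link-sym n u) ◅ [])  ≡⟨ weight-◅◅ c′ _ ⟩
    weight c′ ℚ.+ (cost e ℚ.+ 0ℚ)          ≡⟨ cong (weight c′ ℚ.+_) (ℚP.+-identityʳ (cost e)) ⟩
    weight c′ ℚ.+ cost e                   ≡⟨ ℚP.+-comm (weight c′) (cost e) ⟩
    cost e ℚ.+ weight c′                   ≡⟨ cong (cost e ℚ.+_) eq ⟩
    cost e ℚ.+ weight c                    ∎)
    where open ≡-Reasoning

  -- The outcome of cutting a chain at one step. The length bounds serve the recursion in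
  -- `weight<⇒Link`.
  record Split (x z : X) (k : ℕ) (total a b : ℚ) : Set where
    field
      {u v}     : X
      left      : Chain x u
      middle    : Step u v
      right     : Chain v z
      left-len  : length left ℕ.≤ k
      right-len : length right ℕ.≤ k
      left<     : weight left ℚ.< a
      middle≤   : cost middle ℚ.≤ total
      right<    : weight right ℚ.< b

  -- The middle is the first step at which the accumulated weight reaches `a`; what follows weighs
  -- less than `b` because the total is below `a + b`. If `a` is never reached, the last step is the
  -- middle.
  split : ∀ {x y z} (e : Step x y) (c : Chain y z) a b → 0ℚ ℚ.< a → 0ℚ ℚ.< b →
          weight (e ◅ c) ℚ.< a ℚ.+ b → Split x z (length c) (weight (e ◅ c)) a b
  split e c a b 0<a 0<b total< with cost e ℚP.<? a
  split e c a b 0<a 0<b total< | no e≮a = record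
    { left      = []
    ; middle    = e
    ; right     = c
    ; left-len  = ℕ.z≤n
    ; right-len = ℕP.≤-refl
    ; left<     = 0<a
    ; middle≤   = subst (ℚ._≤ weight (e ◅ c)) (ℚP.+-identityʳ (cost e))
                    (ℚP.+-monoʳ-≤ (cost e) (weight-nonneg c))
    ; right<    = +-cancelˡ-< (cost e) (ℚP.<-≤-trans total< (ℚP.+-monoˡ-≤ b (ℚP.≮⇒≥ e≮a)))
    }
  split e [] a b 0<a 0<b total< | yes e<a = record
    { left      = []
    ; middle    = e
    ; right     = []
    ; left-len  = ℕ.z≤n
    ; right-len = ℕ.z≤n
    ; left<     = 0<a
    ; middle≤   = ℚP.≤-reflexive (sym (ℚP.+-identityʳ (cost e)))
    ; right<    = 0<b
    }
  -- Here `e` joins the left piece, which leaves the budget `a - cost e` for the rest of that piece.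
  split e (e′ ◅ c) a b 0<a 0<b total< | yes e<a = record
    { left      = e ◅ S.left
    ; middle    = S.middle
    ; right     = S.right
    ; left-len  = ℕ.s≤s S.left-len
    ; right-len = ℕP.m≤n⇒m≤1+n S.right-len
    ; left<     = q<r-p⇒p+q<r {cost e} S.left<
    ; middle≤   = ℚP.≤-trans S.middle≤ (subst (ℚ._≤ weight (e ◅ e′ ◅ c)) (ℚP.+-identityˡ _)
                    (ℚP.+-monoˡ-≤ (weight (e′ ◅ c)) (ℚP.<⇒≤ (cost-pos e))))
    ; right<    = S.right<
    }
    where
      regroup : cost e ℚ.+ ((a ℚ.- cost e) ℚ.+ b) ≡ a ℚ.+ b
      regroup = trans (sym (ℚP.+-assoc (cost e) (a ℚ.- cost e) b))
                      (cong (ℚ._+ b) (p+[q-p]≡q (cost e) a))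

      module S = Split (split e′ c (a ℚ.- cost e) b (p<q⇒0<q-p e<a) 0<b
        (+-cancelˡ-< (cost e) (subst (weight (e ◅ e′ ◅ c) ℚ.<_) (sym regroup) total<)))

  -- Frink's lemma: cut the chain where half of the weight 2⁻ⁿ is exceeded; the
  -- two remaining pieces and the step between them are all of level suc n.
  weight<⇒Link : ∀ n {x y} (c : Chain x y) → weight c ℚ.< 2^- n → Link n x y
  weight<⇒Link n c = go (length c) n c ℕP.≤-refl
    where
      -- The pieces are not subterms of the chain, so the recursion runs on a bound `k` for the
      -- length.
      go : ∀ k n {x y} (c : Chain x y) → length c ℕ.≤ k → weight c ℚ.< 2^- n → Link n x y
      go _       n []       _             _  = Link-refl n _
      go (suc k) n (e ◅ c) (ℕ.s≤s len≤k) c< =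
        Link-comp n
          (go k (suc n) S.left (ℕP.≤-trans S.left-len len≤k) S.left<)
          -- The middle step costs strictly less than 2⁻ⁿ, so its level is at least `suc n`.
          (Link-antitone (2^-cancel-< {proj₁ S.middle} (ℚP.≤-<-trans S.middle≤ c<)) (proj₂ S.middle))
          (go k (suc n) S.right (ℕP.≤-trans S.right-len len≤k) S.right<)
        where
          module S = Split (split e c (2^- (suc n)) (2^- (suc n)) (2^-pos (suc n)) (2^-pos (suc n))
            (subst (weight (e ◅ c) ℚ.<_) (sym (2^-suc+2^-suc n)) c<))

  -- The infimum of the weights of all chains; with upper cuts it is a union, and no lightest chain
  -- has to be found.
  dist : X → X → ℝ
  dist x y = record
    { Above     = λ q → ∃ λ (c : Chain x y) → weight c ℚ.< q
    ; inhabited = 2^- 0 ℚ.+ 0ℚ ℚ.+ 1ℚ , (0 , tt) ◅ [] , q<q+1 (2^- 0 ℚ.+ 0ℚ)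
    ; proper    = 0ℚ , λ (c , c<0) → ℚP.<-irrefl refl (ℚP.≤-<-trans (weight-nonneg c) c<0)
    ; upward    = λ (c , c<p) p<q → c , ℚP.<-trans c<p p<q
    ; open-     = λ (c , c<q) → let m , c<m , m<q = ℚP.<-dense c<q in m , m<q , c , c<m
    }

  dist-nonneg : ∀ x y → 0ℝ ≤ dist x y
  dist-nonneg x y q (c , c<q) = ℚP.≤-<-trans (weight-nonneg c) c<q

  dist≤1 : ∀ x y → dist x y ≤ 1ℝ
  dist≤1 x y q 1<q = (0 , tt) ◅ [] , 1<q

  dist-refl : ∀ x → dist x x ≃ 0ℝ
  dist-refl x = (λ q 0<q → [] , 0<q) , dist-nonneg x x

  dist-swap : ∀ x y → dist x y ≤ dist y x
  dist-swap x y q (c , c<q) with reversal c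
  ... | c′ , eq = c′ , subst (ℚ._< q) (sym eq) c<q

  dist-triangle : ∀ x y z → dist x z ≤ dist x y + dist y z
  dist-triangle x y z q (r , s , (c , c<r) , (c′ , c′<s) , r+s<q) =
    c ◅◅ c′ , subst (ℚ._< q) (sym (weight-◅◅ c c′)) (ℚP.<-trans (ℚP.+-mono-< c<r c′<s) r+s<q)

  dist<2^-suc⇒V : ∀ {n x y} → Above (dist x y) (2^- (suc n)) → V n x y
  dist<2^-suc⇒V {n} (c , c<) = weight<⇒Link (suc n) c c<

  -- `V n` is the link of level `suc n`, so a single step costs only half of 2⁻ⁿ, which gives the
  -- strict bound.
  V⇒dist<2^- : ∀ {n x y} → V n x y → Above (dist x y) (2^- n)
  V⇒dist<2^- {n} v = (suc n , v) ◅ [] , subst (ℚ._< 2^- n) (sym (ℚP.+-identityʳ _)) (2^-suc< n)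

  infix 4 _≋_
  _≋_ : X → X → Set
  x ≋ y = dist x y ≃ 0ℝ

  ≋-sym : ∀ {x y} → x ≋ y → y ≋ x
  ≋-sym {x} {y} (p , _) = (λ q 0<q → dist-swap y x q (p q 0<q)) , dist-nonneg y x

  -- A chain `c` of weight below `q` leaves the slack `q - weight c`, and points at distance zero
  -- are joined by a chain lighter than that.
  ≋⇒dist≤ : ∀ {x x′ y} → x ≋ x′ → dist x y ≤ dist x′ y
  ≋⇒dist≤ (p , _) q (c , c<q) =
    case p (q ℚ.- weight c) (p<q⇒0<q-p c<q) of λ (c′ , c′<) →
      c′ ◅◅ c , subst (ℚ._< q) (trans (ℚP.+-comm (weight c) (weight c′)) (sym (weight-◅◅ c′ c)))
                  (q<r-p⇒p+q<r {weight c} c′<)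

  ≋-trans : ∀ {x y z} → x ≋ y → y ≋ z → x ≋ z
  ≋-trans {x} {y} {z} p (r , _) =
    (λ q 0<q → ≋⇒dist≤ p q (r q 0<q)) , dist-nonneg x z

  dist-mono : ∀ {x x′ y y′} → x ≋ x′ → y ≋ y′ → dist x y ≤ dist x′ y′
  dist-mono {x} {x′} {y} {y′} p r q h =
    ≋⇒dist≤ p q (dist-swap x′ y q (≋⇒dist≤ r q (dist-swap y′ x′ q h)))

  space : MetricSpace
  space = record
    { set        = record
        { Carrier       = X
        -- Taking distance zero as the equality of points makes the space separated by definition.
        ; _≈_           = _≋_
        ; isEquivalence = record { refl = dist-refl _ ; sym = ≋-sym ; trans = ≋-trans } }
    ; d          = dist
    ; d-cong     = λ p r → dist-mono p r , dist-mono (≋-sym p) (≋-sym r)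
    ; d-nonneg   = dist-nonneg
    ; d-refl     = dist-refl
    ; d-separate = λ _ _ p → p
    ; d-sym      = λ x y → dist-swap x y , dist-swap y x
    ; d-triangle = dist-triangle
    }

-- Completion of an object of ER(U)

module Completion (A : ERObj) where
  open ERObj A

  R-trans₂ : ∀ η → 0ℚ ℚ.< η → Σ ℚ λ δ → 0ℚ ℚ.< δ × δ ℚ.≤ η ×
             (∀ {x y z} → R x y ≺ δ → R y z ≺ δ → R x z ≺ η)
  R-trans₂ η 0<η =
    case ⊑⇒⊏ R-trans η 0<η of λ (δ , 0<δ , _ , t) →
    case min-bound 0<η 0<δ of λ (m , 0<m , m≤η , m≤δ) →
      m , 0<m , m≤η , λ {x} {y} {z} xy yz →
        t (x , y , z) (≺-mono (R x y) xy m≤δ , ≺-mono (R y z) yz m≤δ)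

  record Refinement (η bound : ℚ) : Set where
    field
      δ        : ℚ
      δ-pos    : 0ℚ ℚ.< δ
      δ≤bound  : δ ℚ.≤ bound
      R-trans₅ : ∀ {a b c d e f} → R a b ≺ δ → R b c ≺ δ → R c d ≺ δ → R d e ≺ δ → R e f ≺ δ →
                 R a f ≺ η

  abstract
    -- Three rounds of transitivity: the first four factors are bracketed in pairs, and the fifth
    -- joins in the outermost round. It is kept opaque so that the radii do not unfold into nested
    -- moduli.
    refine : ∀ {η bound} → 0ℚ ℚ.< η → 0ℚ ℚ.< bound → Refinement η bound
    refine {η} {bound} 0<η 0<bound =
      case R-trans₂ η 0<η of λ (δ₁ , 0<δ₁ , _ , t₁) →
      case R-trans₂ δ₁ 0<δ₁ of λ (δ₂ , 0<δ₂ , δ₂≤δ₁ , t₂) →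
      case R-trans₂ δ₂ 0<δ₂ of λ (δ₃ , 0<δ₃ , δ₃≤δ₂ , t₃) →
      case min-bound 0<δ₃ 0<bound of λ (m , 0<m , m≤δ₃ , m≤bound) →
        record
          { δ        = m
          ; δ-pos    = 0<m
          ; δ≤bound  = m≤bound
          ; R-trans₅ = λ {a} {b} {c} {d} {e} {f} ab bc cd de ef →
              t₁ (t₂ (t₃ (≺-mono (R a b) ab m≤δ₃) (≺-mono (R b c) bc m≤δ₃))
                     (t₃ (≺-mono (R c d) cd m≤δ₃) (≺-mono (R d e) de m≤δ₃)))
                 (≺-mono (R e f) ef (ℚP.≤-trans m≤δ₃ (ℚP.≤-trans δ₃≤δ₂ δ₂≤δ₁)))
          }

  mutual
    -- Refining a radius requires its positivity, hence the mutual definition. The bound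
    -- `2^- (suc n)` drives the radii to zero, so that the relations `V n` recover `R` up to `⊑`.
    radius : ℕ → ℚ
    radius zero    = 2^- 0
    radius (suc n) = Refinement.δ (refinement n)

    radius-pos : ∀ n → 0ℚ ℚ.< radius n
    radius-pos zero    = 2^-pos 0
    radius-pos (suc n) = Refinement.δ-pos (refinement n)

    refinement : ∀ n → Refinement (radius n) (2^- (suc n))
    refinement n = refine (radius-pos n) (2^-pos (suc n))

  radius≤2^- : ∀ n → radius n ℚ.≤ 2^- n
  radius≤2^- zero    = ℚP.≤-refl
  radius≤2^- (suc n) = Refinement.δ≤bound (refinement n)

  -- A record, unlike its unfolding, lets n, x and y be inferred.
  record V (n : ℕ) (x y : Carrier) : Set where
    constructor mkV
    field
      forth : R x y ≺ radius n
      back  : R y x ≺ radius n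

  V-refl : ∀ n x → V n x x
  V-refl n x = mkV (R-refl≺ x (radius-pos n)) (R-refl≺ x (radius-pos n))

  V-sym : ∀ {n x y} → V n x y → V n y x
  V-sym (mkV xy yx) = mkV yx xy

  V-comp₅ : ∀ {n a b c d e f} → V (suc n) a b → V (suc n) b c → V (suc n) c d →
            V (suc n) d e → V (suc n) e f → V n a f
  V-comp₅ {n} (mkV ab ba) (mkV bc cb) (mkV cd dc) (mkV de ed) (mkV ef fe) =
    mkV (R-trans₅ ab bc cd de ef) (R-trans₅ fe ed dc cb ba)
    where open Refinement (refinement n)

  V-comp₃ : ∀ {n a b c d} → V (suc n) a b → V (suc n) b c → V (suc n) c d → V n a d
  V-comp₃ {n} {d = d} ab bc cd = V-comp₅ ab bc cd (V-refl (suc n) d) (V-refl (suc n) d)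

  V-antitone : ∀ {m n} → m ℕ.≤ n → ∀ {x y} → V n x y → V m x y
  V-antitone {m} m≤n = go (ℕP.≤⇒≤′ m≤n)
    where
      go : ∀ {n} → m ℕ.≤′ n → ∀ {x y} → V n x y → V m x y
      go (ℕ.≤′-reflexive refl)     u = u
      go (ℕ.≤′-step {n} m≤′n) {y = y} u =
        go m≤′n (V-comp₃ u (V-refl (suc n) y) (V-refl (suc n) y))

  -- `V` demands smallness in both directions; the reverse one comes from the modulus of `R-sym`.
  R≺⇒V : ∀ n → Σ ℚ λ δ → 0ℚ ℚ.< δ × δ ℚ.≤ 1ℚ × (∀ {x y} → R x y ≺ δ → V n x y)
  R≺⇒V n =
    case ⊑⇒⊏ R-sym (radius n) (radius-pos n) of λ (δ , 0<δ , δ≤1 , s) →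
    case min-bound 0<δ (radius-pos n) of λ (m , 0<m , m≤δ , m≤r) →
      m , 0<m , ℚP.≤-trans m≤δ δ≤1 , λ {x} {y} xy →
        mkV (≺-mono (R x y) xy m≤r) (s (x , y) (≺-mono (R x y) xy m≤δ))

  V⇒R≺ : ∀ {n q} → 2^- n ℚ.< q → ∀ {x y} → V n x y → R x y ≺ q
  V⇒R≺ {n} n<q {x} {y} (mkV xy _) = ≺-mono (R x y) xy (ℚP.≤-trans (radius≤2^- n) (ℚP.<⇒≤ n<q))

  -- The level `suc m` is one finer than the index, so that a change of index can enter a composite
  -- that lands in `V m`.
  record FastSequence : Set where
    field
      seq  : ℕ → Carrier
      fast : ∀ {m n} → m ℕ.≤ n → V (suc m) (seq m) (seq n)

  open FastSequence

  V̂ : ℕ → FastSequence → FastSequence → Set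
  V̂ n s t = V n (seq s n) (seq t n)

  -- The two outer steps of the five-fold composition change the index from n
  -- to suc n and back.
  V̂-comp : ∀ {n s t u v} → V̂ (suc n) s t → V̂ (suc n) t u → V̂ (suc n) u v → V̂ n s v
  V̂-comp {n} {s} {v = v} st tu uv =
    V-comp₅ (fast s (ℕP.n≤1+n n)) st tu uv (V-sym (fast v (ℕP.n≤1+n n)))

  open Metrization V̂ (λ n s → V-refl n (seq s n)) V-sym (λ {n} {s} {t} {u} {v} → V̂-comp {n} {s} {t} {u} {v})
    public using (space; dist; dist≤1; dist<2^-suc⇒V; V⇒dist<2^-)

  V̂⇒dist≺ : ∀ {n q} → 2^- n ℚ.< q → ∀ {s t} → V̂ n s t → Above (dist s t) q
  V̂⇒dist≺ n<q {s} {t} v = ℝ.upward (dist s t) (V⇒dist<2^- v) n<q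

  -- The limit is a diagonal: its `k`th term comes from a member of `s` at the Cauchy modulus for
  -- level `2 + k`.
  complete : IsComplete space
  complete s cauchy = limit , ≺⇒converges space {s} {limit} converges
    where
      modulus : ∀ k → ∃ λ N → ∀ m n → N ℕ.≤ m → N ℕ.≤ n → V̂ k (s m) (s n)
      modulus k =
        case cauchy⇒≺ space {s} cauchy (2^- (suc k)) (2^-pos (suc k)) of λ (N , h) →
          N , λ m n N≤m N≤n → dist<2^-suc⇒V (h m n N≤m N≤n)

      N : ℕ → ℕ
      N k = proj₁ (modulus k)

      close : ∀ k {m n} → N k ℕ.≤ m → N k ℕ.≤ n → V̂ k (s m) (s n)
      close k = proj₂ (modulus k) _ _

      limit : FastSequence
      limit = record
        -- The offset is 2 because three links of level `2 + m` compose to level `suc m`, which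
        -- `fast` demands.
        { seq  = λ k → seq (s (N (2 ℕ.+ k))) (2 ℕ.+ k)
        ; fast = λ {m} {n} m≤n →
            let 2+m≤2+n = ℕP.+-monoʳ-≤ 2 m≤n
                -- Past both moduli, `s M` is a go-between: cross to it at index `2 + m`, move along
                -- it to index `2 + n`, and cross over again.
                M = N (2 ℕ.+ m) ℕ.⊔ N (2 ℕ.+ n)
            in V-comp₃
                 (close (2 ℕ.+ m) ℕP.≤-refl (ℕP.m≤m⊔n (N (2 ℕ.+ m)) (N (2 ℕ.+ n))))
                 (V-antitone (ℕP.n≤1+n _) (fast (s M) 2+m≤2+n))
                 (V-antitone 2+m≤2+n (close (2 ℕ.+ n) (ℕP.m≤n⊔m (N (2 ℕ.+ m)) (N (2 ℕ.+ n))) ℕP.≤-refl))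
        }

      converges : ∀ q → 0ℚ ℚ.< q → ∃ λ M → ∀ n → M ℕ.≤ n → Above (dist (s n) limit) q
      converges q 0<q =
        case 2^-archimedean q 0<q of λ (k , k<q) →
          N (2 ℕ.+ k) , λ n N≤n → V̂⇒dist≺ k<q {s n} {limit}
            -- The `k`th term of the limit has index `2 + k` in its source, so `s n` is first
            -- followed to that index and compared there.
            (V-comp₃ (fast (s n) (ℕP.m≤n+m k 2))
                     (V-antitone (ℕP.n≤1+n _) (close (2 ℕ.+ k) N≤n ℕP.≤-refl))
                     (V-refl (suc k) _))

  completion : CompleteMetricSpace₁
  completion = record { space = space ; complete = complete ; d≤1 = dist≤1 }

  constant : Carrier → FastSequence
  constant x = record { seq = λ _ → x ; fast = λ {m} _ → V-refl (suc m) x }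

  constant-preserves : _⊏_ {Carrier × Carrier} (λ (x , y) → R x y)
    (λ (x , y) → ERObj.R (G₀ completion) (constant x) (constant y))
  constant-preserves η 0<η =
    case 2^-archimedean η 0<η of λ (n , n<η) →
    case R≺⇒V n of λ (δ , 0<δ , δ≤1 , v) →
      δ , 0<δ , δ≤1 , λ (x , y) xy → V̂⇒dist≺ n<η {constant x} {constant y} (v xy)

  constant-isDenseEmbedding : IsDenseEmbedding {A} {G₀ completion} constant
  constant-isDenseEmbedding = record
    { i-cong    = λ {x} {y} x≈y → indiscernible⇒≈ space (constant x) (constant y) λ q 0<q →
        case constant-preserves q 0<q of λ (δ , 0<δ , _ , p) →
          p (x , y) (proj₁ (R-cong (Setoid.refl set) (Setoid.sym set x≈y)) δ (R-refl≺ x 0<δ))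
    ; preserves = constant-preserves
    ; reflects  = λ η 0<η →
        case 2^-archimedean η 0<η of λ (n , n<η) →
          -- By Frink's lemma, distance below this threshold forces `V̂ n`, which for constant
          -- sequences is `V n` of their values.
          2^- (suc n) , 2^-pos (suc n) , 2^-antitone {0} {suc n} ℕ.z≤n , λ (x , y) p →
            V⇒R≺ n<η (dist<2^-suc⇒V {n} {constant x} {constant y} p)
    ; dense     = λ s q 0<q →
        case 2^-archimedean q 0<q of λ (n , n<q) →
          -- `V̂ n` compares only the `n`th terms, and those of `s` and of this constant sequence
          -- coincide.
          seq s n , V̂⇒dist≺ n<q {s} {constant (seq s n)} (V-refl n (seq s n))
    }

-- Essential surjectivity and the equivalence

G-essentiallySurjective : EssentiallySurjective G
G-essentiallySurjective A =
  completion , denseEmbedding⇒iso {A} {G₀ completion} constant constant-isDenseEmbedding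
  where open Completion A

mainTheorem11 : IsEquivalenceOfCategories G
mainTheorem11 = fullyFaithful∧surjective⇒equivalence G (λ {A} {B} → G-full {A} {B}) G-faithful G-essentiallySurjective
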